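{- For every $w\in S_n$ ($n\geq1$), the Stanley symmetric function $F_w\in\mathsf{Sym}$ has saturated Newton polytope.
   Context: Let $\partial_i f=\frac{f-s_if}{x_i-x_{i+1}}$, where $s_i$ swaps $x_i,x_{i+1}$. For $w\in S_n$, the Schubert polynomial $\mathfrak{S}_w$ is defined by $\mathfrak{S}_{w_0}=x_1^{n-1}x_2^{n-2}\cdots x_{n-1}$ for $w_0=n\,n{ - }1\cdots1$, and $\mathfrak{S}_w=\partial_i\mathfrak{S}_{ws_i}$ whenever $w(i)<w(i+1)$ (where $ws_i$ is $w$ with positions $i,i+1$ of its one-line notation swapped); this is well defined and unchanged under the inclusion $S_n\hookrightarrow S_{n+1}$. For $w\in S_n$ and $t\geq0$ let $1^t\times w\in S_{t+n}$ be given by $(1^t\times w)(i)=i$ for $i\leq t$ and $(1^t\times w)(i)=t+w(i-t)$ for $t<i\leq t+n$. The Stanley symmetric function is $F_w=\lim_{t\to\infty}\mathfrak{S}_{1^t\times w}$ (coefficientwise limit), an element of the ring $\mathsf{Sym}$ of symmetric functions in $x_1,x_2,\ldots$. A polynomial $g=\sum c_\alpha x^\alpha$ has saturated Newton polytope (SNP) if every lattice point of $\mathrm{conv}\{\alpha:c_\alpha\neq0\}$ is an exponent vector with nonzero coefficient; $f\in\mathsf{Sym}$ is SNP if $f(x_1,\ldots,x_m)$ (setting $x_i=0$ for $i>m$) is SNP for every $m\geq1$. -}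

module Defs where

open import Data.Nat using (ℕ; _<?_; zero; suc; _+_; _*_; _∸_; _<ᵇ_; _≡ᵇ_; _⊔_; _≤_)
open import Data.Bool using (Bool; true; false; if_then_else_; _∧_)
open import Data.Integer as ℤ using (ℤ)
open import Data.List using (List; []; _∷_; map; concatMap; upTo; foldr; sum; filter; _++_)
open import Data.Maybe using (Maybe; just; nothing)
open import Data.Product using (_×_; _,_; proj₁; proj₂; Σ; ∃)
open import Data.Fin using (Fin; toℕ; fromℕ<)
open import Relation.Nullary using (yes; no)
open import Data.List.Relation.Unary.All using (All)
open import Data.Fin.Permutation using (Permutation′; _⟨$⟩ʳ_)
open import Data.Vec as Vec using (Vec)
open import Data.Rational as ℚ using (ℚ)
open import Relation.Binary.PropositionalEquality using (_≡_; _≢_)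

-- Polynomials with integer coefficients in variables x_1, x_2, ...
-- (0-based: variable index 0 is x_1). A polynomial is a finite formal
-- sum of terms (exponent list, coefficient); entries beyond the end of
-- an exponent list are 0. Terms need not be combined: the coefficient
-- of a monomial is the sum over all matching terms.

Exponent : Set
Exponent = List ℕ

Poly : Set
Poly = List (Exponent × ℤ)

expAt : Exponent → ℕ → ℕ
expAt []       _       = 0
expAt (a ∷ e)  zero    = a
expAt (a ∷ e)  (suc i) = expAt e i

setAt : Exponent → ℕ → ℕ → Exponent
setAt []      zero    v = v ∷ []
setAt []      (suc i) v = 0 ∷ setAt [] i v
setAt (a ∷ e) zero    v = v ∷ e
setAt (a ∷ e) (suc i) v = a ∷ setAt e i v

len : Exponent → ℕ
len []      = 0
len (_ ∷ e) = suc (len e)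

allBelow : ℕ → (ℕ → Bool) → Bool
allBelow zero    p = true
allBelow (suc k) p = allBelow k p ∧ p k

expEqᵇ : Exponent → Exponent → Bool
expEqᵇ e f = allBelow (len e ⊔ len f) (λ i → expAt e i ≡ᵇ expAt f i)

coeff : Poly → Exponent → ℤ
coeff []            e = ℤ.0ℤ
coeff ((f , c) ∷ p) e = (if expEqᵇ f e then c else ℤ.0ℤ) ℤ.+ coeff p e

-- Divided difference ∂_i (0-based: ∂ i acts on variables index i, i+1,
-- i.e. on x_{i+1}, x_{i+2} in 1-based notation).
-- ∂_i f = (f - s_i f)/(x_i - x_{i+1}) is linear; on a monomial with
-- exponents a at i and b at i+1 it is given by the exact quotient
--   a > b :   Σ_{k=0}^{a-b-1} x_i^{a-1-k} x_{i+1}^{b+k}   (times the rest)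
--   a = b :   0
--   a < b : - Σ_{k=0}^{b-a-1} x_i^{b-1-k} x_{i+1}^{a+k}
-- (this is literally the polynomial division (f - s_i f)/(x_i - x_{i+1})).

ddTerm : ℕ → Exponent × ℤ → Poly
ddTerm i (e , c) with expAt e i | expAt e (suc i)
... | a | b =
  if b <ᵇ a
  then map (λ k → (setAt (setAt e i (a ∸ 1 ∸ k)) (suc i) (b + k) , c)) (upTo (a ∸ b))
  else map (λ k → (setAt (setAt e i (b ∸ 1 ∸ k)) (suc i) (a + k) , ℤ.- c)) (upTo (b ∸ a))

∂ : ℕ → Poly → Poly
∂ i p = concatMap (ddTerm i) p

-- Permutations of size N in one-line notation, 0-based:
-- u : ℕ → ℕ, with u 0 , … , u (N-1) a permutation of 0 , … , N-1.

swapPos : (ℕ → ℕ) → ℕ → (ℕ → ℕ)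
swapPos u i j =
  if j ≡ᵇ i then u (suc i) else if j ≡ᵇ suc i then u i else u j

firstAscentFrom : ℕ → ℕ → (ℕ → ℕ) → Maybe ℕ
firstAscentFrom zero    i u = nothing
firstAscentFrom (suc k) i u =
  if u i <ᵇ u (suc i) then just i else firstAscentFrom k (suc i) u

firstAscent : ℕ → (ℕ → ℕ) → Maybe ℕ
firstAscent N u = firstAscentFrom (N ∸ 1) 0 u

stairs : ℕ → Exponent
stairs zero    = []
stairs (suc k) = k ∷ stairs k

schubTop : ℕ → Poly
schubTop N = (stairs N , ℤ.1ℤ) ∷ []

-- Schubert polynomial via  S_w = ∂_i S_{w s_i}  (w(i) < w(i+1)), using the
-- first ascent; with no ascent w = w0. Each step increases the number of
-- inversions, so fuel N*N suffices for permutations of size N.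
schubFuel : ℕ → ℕ → (ℕ → ℕ) → Poly
schubFuel N zero       u = []
schubFuel N (suc fuel) u with firstAscent N u
... | nothing = schubTop N
... | just i  = ∂ i (schubFuel N fuel (swapPos u i))

schubert : ℕ → (ℕ → ℕ) → Poly
schubert N u = schubFuel N (N * N) u

oneLine : ∀ {n} → Permutation′ n → ℕ → ℕ
oneLine {n} w j with j <? n
... | yes j<n = toℕ (w ⟨$⟩ʳ fromℕ< j<n)
... | no  _   = j

shiftPerm : ∀ {n} → ℕ → Permutation′ n → ℕ → ℕ
shiftPerm t w j = if j <ᵇ t then j else t + oneLine w (j ∸ t)

schubShift : ∀ {n} → ℕ → Permutation′ n → Poly
schubShift {n} t w = schubert (t + n) (shiftPerm t w)

-- Stanley symmetric function F_w = lim_t S_{1^t × w}, coefficientwise.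
-- "the coefficient of x^e in F_w equals c": the coefficient of x^e in
-- S_{1^t × w} is eventually (for all large t) equal to c.

StanleyCoeff : ∀ {n} → Permutation′ n → Exponent → ℤ → Set
StanleyCoeff w e c = ∃ λ T → ∀ t → T ≤ t → coeff (schubShift t w) e ≡ c

InSupport : ∀ {n} → Permutation′ n → Exponent → Set
InSupport w e = ∃ λ c → StanleyCoeff w e c × c ≢ ℤ.0ℤ

ConvexCombination : (m : ℕ) → List (Vec ℕ m × ℚ) → Vec ℕ m → Set
ConvexCombination m L β =
  All (λ p → ℚ.0ℚ ℚ.≤ proj₂ p) L
  × sum′ (map proj₂ L) ≡ ℚ.1ℚ
  × (∀ (i : Fin m) →
       sum′ (map (λ p → proj₂ p ℚ.* (ℤ.+ Vec.lookup (proj₁ p) i ℚ./ 1)) L)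
       ≡ (ℤ.+ Vec.lookup β i ℚ./ 1))
  where
  sum′ : List ℚ → ℚ
  sum′ = foldr ℚ._+_ ℚ.0ℚ

-- SNP for F_w: for every m, every lattice point of the convex hull of the
-- exponent vectors of F_w(x_1,…,x_m) is itself such an exponent vector.
-- (Setting x_i = 0 for i > m keeps exactly the monomials supported in the
-- first m variables; Vec.toList α is the exponent α padded with zeros.)
StanleySNP : ∀ {n} → Permutation′ n → Set
StanleySNP w =
  ∀ (m : ℕ) (L : List (Vec ℕ m × ℚ)) (β : Vec ℕ m) →
    All (λ p → InSupport w (Vec.toList (proj₁ p))) L →
    ConvexCombination m L β →
    InSupport w (Vec.toList β)

{-# OPTIONS --safe #-}
module Submission where

open import Defs

open import Algebra.Bundles using (module CommutativeMonoid)
import Algebra.Properties.AbelianGroup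
import Algebra.Properties.CommutativeSemigroup
open import Data.Bool as Bool using (Bool; true; false; if_then_else_; _∧_)
open import Data.Bool.ListAction using (all)
open import Data.Fin as Fin using (Fin; zero; suc; fromℕ<)
import Data.Fin.Properties as Fin
open import Data.Fin.Permutation using (Permutation′; _⟨$⟩ʳ_; _⟨$⟩ˡ_; inverseˡ)
open import Data.Integer as ℤ using (ℤ) renaming (_+_ to _⊕_)
import Data.Integer.Properties as ℤ
import Data.Integer.Tactic.RingSolver as ℤRing
open import Data.List using (List; []; _∷_; _++_; [_]; length; map; upTo; applyUpTo; foldr)
open import Data.List.Properties using (length-applyUpTo; map-++; upTo-∷ʳ)
open import Data.List.Relation.Binary.Permutation.Propositional
  using (_↭_; prep; swap; ↭-refl; ↭-trans; ↭-sym)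
open import Data.List.Relation.Binary.Permutation.Propositional.Properties
  using (All-resp-↭; ↭-length; ¬x∷xs↭[])
open import Data.List.Relation.Unary.All as All using (All; []; _∷_)
import Data.List.Relation.Unary.All.Properties as All
open import Data.List.Relation.Unary.AllPairs using (AllPairs; []; _∷_)
open import Data.List.Relation.Unary.Linked using (Linked; []; [-]; _∷_)
import Data.List.Relation.Unary.Linked.Properties as Linked
open import Data.List.Relation.Unary.Unique.Propositional using (Unique)
import Data.List.Relation.Unary.Unique.Propositional.Properties as Unique
open import Data.Maybe using (just; nothing)
open import Data.Nat
open import Data.Nat.Properties
open import Data.Nat.Tactic.RingSolver using (solve-∀)
open import Data.Product using (_×_; _,_; proj₁; proj₂; ∃; ∃₂)
open import Data.Rational as ℚ using (ℚ; 0ℚ)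
import Data.Rational.Properties as ℚ
open import Data.Rational.Unnormalised as ℚᵘ using (mkℚᵘ; *≡*; *≤*)
import Data.Rational.Unnormalised.Properties as ℚᵘ
open import Data.Sum using (_⊎_; inj₁; inj₂)
open import Data.Vec using (Vec; []; _∷_; replicate; lookup; toList)
open import Function using (_∘_; case_of_; id)
open import Relation.Binary.Definitions using (tri<; tri≈; tri>)
open import Relation.Binary.PropositionalEquality hiding ([_])
open import Relation.Nullary using (yes; no; contradiction)

open Algebra.Properties.AbelianGroup ℤ.+-0-abelianGroup using (∙-cancelʳ)
open Algebra.Properties.CommutativeSemigroup +-commutativeSemigroup
  using (interchange; x∙yz≈y∙xz; x∙yz≈yx∙z; xy∙z≈xz∙y)
open Algebra.Properties.CommutativeSemigroup ℤ.+-commutativeSemigroup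
  using () renaming (interchange to ℤ-interchange; xy∙z≈xz∙y to ℤ-xy∙z≈xz∙y)
open Algebra.Properties.CommutativeSemigroup
  (CommutativeMonoid.commutativeSemigroup ℚ.+-0-commutativeMonoid)
  using () renaming (interchange to ℚ-interchange)

-- The factor of x_i in the Fomin–Stanley product of all 1 + x_i u_j acts on a one-line word as a partial
-- bubble-sort pass: an entry is carried to the right past smaller entries, and may at any moment be
-- dropped in favour of the next one; the exponent of x_i counts the jumps. Two passes commute, which
-- gives the recursion by divided differences. In the limit 1^t × w, the coefficient of x^e in F_w counts
-- the ways to sort w by passes with e_1, …, e_m jumps.
--
-- Let c_y be the number of larger entries to the left of y. A pass lowers each c_y by at most one, so
-- sortability forces Σ_{i∈K} e_i ≤ Σ_y min(c_y, |K|) for every set K of passes, and Σ e_i = Σ c_y.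
-- Conversely, if at least p entries have c_y > 0, a pass can jump over the p entries with the largest c_y, and, as
-- in the Gale–Ryser theorem, this preserves the inequalities. Hence they describe the support, and they
-- are linear in e.

-- Divided differences produce signs, so nothing can be read off about the support before the
-- coefficients are known to be natural numbers. The passes supply this: a coefficient becomes a
-- number of paths, and it is nonzero as soon as one path exists. The results of a pass are not
-- listed but consumed by a weight `φ` on words. An identity between multisets of resulting words is
-- then an equation in ℕ for every `φ`, and induction along the word works by putting the emitted
-- letter into `φ`. Let λ be the partition conjugate to the sorted numbers c_y. Then Σ_y min(c_y, j)
-- = λ_1 + ... + λ_j, so the inequalities cut out the permutohedron of λ, which is also the Newton
-- polytope of the Schur function s_λ.

private
  variable
    p x y : ℕ
    k l l′ : List ℕ
    φ ψ : List ℕ → ℕ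

-- Partial bubble-sort passes

when : Bool → ℕ → ℕ
when c n = if c then n else 0

-- carry (suc p) φ x l sums φ over the results of all passes along l that start with x in hand and make
-- p jumps. The index is shifted so that carry 0 is zero, whence pred p stays correct at p = 0.
carry : ℕ → (List ℕ → ℕ) → ℕ → List ℕ → ℕ
carry p φ x []      = when (p ≡ᵇ 1) (φ (x ∷ []))
carry p φ x (y ∷ l) =
  carry p (φ ∘ (x ∷_)) y l + when (y <ᵇ x) (carry (pred p) (φ ∘ (y ∷_)) x l)

carry-cong : ∀ p x l → (∀ l′ → l′ ↭ x ∷ l → φ l′ ≡ ψ l′) → carry p φ x l ≡ carry p ψ x l
carry-cong p x []      eq = cong (when (p ≡ᵇ 1)) (eq _ ↭-refl)
carry-cong p x (y ∷ l) eq = cong₂ (λ m n → m + when (y <ᵇ x) n)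
  (carry-cong p y l (λ l′ r → eq (x ∷ l′) (prep x r)))
  (carry-cong (pred p) x l (λ l′ r → eq (y ∷ l′) (↭-trans (prep y r) (swap y x ↭-refl))))

when-+ : ∀ c m n → when c (m + n) ≡ when c m + when c n
when-+ true  m n = refl
when-+ false m n = refl

carry-+ : ∀ p φ ψ x l → carry p (λ l′ → φ l′ + ψ l′) x l ≡ carry p φ x l + carry p ψ x l
carry-+ p φ ψ x []      = when-+ (p ≡ᵇ 1) _ _
carry-+ p φ ψ x (y ∷ l)
  rewrite carry-+ p (φ ∘ (x ∷_)) (ψ ∘ (x ∷_)) y l
        | carry-+ (pred p) (φ ∘ (y ∷_)) (ψ ∘ (y ∷_)) x l
        | when-+ (y <ᵇ x) (carry (pred p) (φ ∘ (y ∷_)) x l) (carry (pred p) (ψ ∘ (y ∷_)) x l)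
  = interchange (carry p (φ ∘ (x ∷_)) y l) (carry p (ψ ∘ (x ∷_)) y l) _ _

when-0 : ∀ c → when c 0 ≡ 0
when-0 true  = refl
when-0 false = refl

carry-zero : ∀ p x l → carry p (λ _ → 0) x l ≡ 0
carry-zero p x []      = when-0 (p ≡ᵇ 1)
carry-zero p x (y ∷ l)
  rewrite carry-zero p y l | carry-zero (pred p) x l = when-0 (y <ᵇ x)

carry-when : ∀ c p φ x l → carry p (λ l′ → when c (φ l′)) x l ≡ when c (carry p φ x l)
carry-when true  p φ x l = refl
carry-when false p φ x l = carry-zero p x l

carry-0 : ∀ φ x l → carry 0 φ x l ≡ 0
carry-0 φ x []      = refl
carry-0 φ x (y ∷ l)
  rewrite carry-0 (φ ∘ (x ∷_)) y l | carry-0 (φ ∘ (y ∷_)) x l = when-0 (y <ᵇ x)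

carry-1 : ∀ φ x l → carry 1 φ x l ≡ φ (x ∷ l)
carry-1 φ x []      = refl
carry-1 φ x (y ∷ l)
  rewrite carry-1 (φ ∘ (x ∷_)) y l | carry-0 (φ ∘ (y ∷_)) x l | when-0 (y <ᵇ x) = +-identityʳ _

<ᵇ-true : x < y → (x <ᵇ y) ≡ true
<ᵇ-true {x} {y} x<y with x <ᵇ y | <⇒<ᵇ x<y
... | true | _ = refl

<ᵇ-false : y ≤ x → (x <ᵇ y) ≡ false
<ᵇ-false {y} {x} y≤x with x <ᵇ y in eq
... | false = refl
... | true  = contradiction (<ᵇ⇒< x y (subst Bool.T (sym eq) _)) (≤⇒≯ y≤x)

-- The entry y is carried first, with the index b; then x is carried along the result, with the index a.
pair : ℕ → ℕ → (List ℕ → ℕ) → ℕ → ℕ → List ℕ → ℕ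
pair a b φ x y l = carry b (carry a φ x) y l

-- Each of the two passes either drops or jumps. The pass carrying `y` meets `z` and emits `y` or
-- `z`; the pass carrying `x` then meets that emitted letter. This gives four cases.
pair-∷ : ∀ a b φ x y z l → pair a b φ x y (z ∷ l) ≡
  (pair a b (φ ∘ (x ∷_)) y z l + when (y <ᵇ x) (pair (pred a) b (φ ∘ (y ∷_)) x z l)) +
  when (z <ᵇ y) (pair a (pred b) (φ ∘ (x ∷_)) z y l +
    when (z <ᵇ x) (pair (pred a) (pred b) (φ ∘ (z ∷_)) x y l))
pair-∷ a b φ x y z l = cong₂ _+_ (split b z y) (cong (when (z <ᵇ y)) (split (pred b) y z))
  where
  split : ∀ b u v → carry b (carry a φ x ∘ (v ∷_)) u l ≡
    pair a b (φ ∘ (x ∷_)) v u l + when (v <ᵇ x) (pair (pred a) b (φ ∘ (v ∷_)) x u l)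
  split b u v = trans (carry-+ b (carry a (φ ∘ (x ∷_)) v) _ u l)
    (cong (pair a b (φ ∘ (x ∷_)) v u l +_)
      (carry-when (v <ᵇ x) b (carry (pred a) (φ ∘ (v ∷_)) x) u l))

-- Both statements express that two full passes over x ∷ y ∷ l commute, hence are proved together.
pair-comm-≤ : ∀ a b φ x y l → x ≤ y → pair a b φ x y l ≡ pair b a φ x y l
pair-comm-> : ∀ a b φ x y l → y < x →
  pair a b φ x y l + pair a (pred b) φ y x l ≡ pair b a φ x y l + pair b (pred a) φ y x l
-- In the inductive step of `pair-comm->`, the final words that begin with the middle letter
-- contribute three terms of this shape to each side. The identity is the sum of two instances of
-- `pair-comm->` on the same tail, from which one instance of `pair-comm-≤` is cancelled.
pair-comm-middle : ∀ a b φ x y l → y < x →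
  pair (pred a) b φ x y l + (pair a (pred b) φ x y l + pair a (pred (pred b)) φ y x l) ≡
  pair (pred b) a φ x y l + (pair b (pred a) φ x y l + pair b (pred (pred a)) φ y x l)

pair-comm-≤ a b φ x y [] x≤y rewrite <ᵇ-false x≤y = base (b ≡ᵇ 1) (a ≡ᵇ 1) _
  where
  base : ∀ c d n → when c (when d n + 0) ≡ when d (when c n + 0)
  base true  true  n = refl
  base true  false n = refl
  base false true  n = refl
  base false false n = refl
pair-comm-≤ a b φ x y (z ∷ l) x≤y
  rewrite pair-∷ a b φ x y z l | pair-∷ b a φ x y z l | <ᵇ-false x≤y
  with z <? y
... | no z≮y rewrite <ᵇ-false (≮⇒≥ z≮y)
  | pair-comm-≤ a b (φ ∘ (x ∷_)) y z l (≮⇒≥ z≮y) = refl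
... | yes z<y rewrite <ᵇ-true z<y
  | pair-comm-≤ (pred a) (pred b) (φ ∘ (z ∷_)) x y l x≤y = begin
    _ ≡⟨ regroup (X a b y z) (X a (pred b) z y) W ⟩
    _ ≡⟨ cong (_+ W) (pair-comm-> a b (φ ∘ (x ∷_)) y z l z<y) ⟩
    _ ≡⟨ regroup (X b a y z) (X b (pred a) z y) W ⟨
    _ ∎
  where
  open ≡-Reasoning
  X : ℕ → ℕ → ℕ → ℕ → ℕ
  X a b u v = pair a b (φ ∘ (x ∷_)) u v l
  W : ℕ
  W = when (z <ᵇ x) (pair (pred b) (pred a) (φ ∘ (z ∷_)) x y l)
  regroup : ∀ a b c → (a + 0) + (b + c) ≡ (a + b) + c
  regroup = solve-∀
pair-comm-> a b φ x y [] y<x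
  rewrite <ᵇ-true y<x | <ᵇ-false (<⇒≤ y<x)
        | +-identityʳ (when (a ≡ᵇ 1) (φ (y ∷ x ∷ []))) | +-identityʳ (when (b ≡ᵇ 1) (φ (y ∷ x ∷ []))) =
  base (b ≡ᵇ 1) (a ≡ᵇ 1) (pred b ≡ᵇ 1) (pred a ≡ᵇ 1) _ _
  where
  base : ∀ c d c′ d′ m n →
    when c (when d m + when d′ n) + when c′ (when d n) ≡
    when d (when c m + when c′ n) + when d′ (when c n)
  base true  true  c′ d′ m n = xy∙z≈xz∙y m (when d′ n) (when c′ n)
  base true  false c′ d′ m n rewrite when-0 c′ = +-identityʳ _
  base false true  c′ d′ m n rewrite when-0 d′ = sym (+-identityʳ _)
  base false false c′ d′ m n rewrite when-0 c′ | when-0 d′ = refl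
pair-comm-> a b φ x y (z ∷ l) y<x
  rewrite pair-∷ a b φ x y z l | pair-∷ b a φ x y z l
        | pair-∷ a (pred b) φ y x z l | pair-∷ b (pred a) φ y x z l
        | <ᵇ-true y<x | <ᵇ-false (<⇒≤ y<x)
  with z <? y | z <? x
... | yes z<y | no z≮x = contradiction (<-trans z<y y<x) z≮x
... | yes z<y | yes z<x rewrite <ᵇ-true z<y | <ᵇ-true z<x = begin
    _ ≡⟨ regroup (X a b x y z) (X (pred a) b y x z) (X a (pred b) x z y) (X (pred a) (pred b) z x y)
           (X a (pred b) y x z) (X a (pred (pred b)) y z x) (X (pred a) (pred (pred b)) z y x) ⟩
    -- The seven terms are grouped by the first letter of the final word: `x`, `y` or `z`.
    _ ≡⟨ cong₂ _+_ (cong₂ _+_ (pair-comm-> a b (φ ∘ (x ∷_)) y z l z<y)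
             (pair-comm-middle a b (φ ∘ (y ∷_)) x z l z<x))
           (pair-comm-> (pred a) (pred b) (φ ∘ (z ∷_)) x y l y<x) ⟩
    _ ≡⟨ regroup (X b a x y z) (X (pred b) a y x z) (X b (pred a) x z y) (X (pred b) (pred a) z x y)
           (X b (pred a) y x z) (X b (pred (pred a)) y z x) (X (pred b) (pred (pred a)) z y x) ⟨
    _ ∎
  where
  open ≡-Reasoning
  X : ℕ → ℕ → ℕ → ℕ → ℕ → ℕ
  X a b u v w = pair a b (φ ∘ (u ∷_)) v w l
  regroup : ∀ p q r s t u v → ((p + q) + (r + s)) + ((t + 0) + (u + v)) ≡
            ((p + r) + (q + (t + u))) + (s + v)
  regroup = solve-∀
... | no z≮y | yes z<x rewrite <ᵇ-false (≮⇒≥ z≮y) | <ᵇ-true z<x = begin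
    _ ≡⟨ regroup (X a b x y z) (X (pred a) b y x z) (X a (pred b) y x z) (X a (pred (pred b)) y z x) ⟩
    _ ≡⟨ cong₂ _+_ (pair-comm-≤ a b (φ ∘ (x ∷_)) y z l (≮⇒≥ z≮y))
           (pair-comm-middle a b (φ ∘ (y ∷_)) x z l z<x) ⟩
    _ ≡⟨ regroup (X b a x y z) (X (pred b) a y x z) (X b (pred a) y x z) (X b (pred (pred a)) y z x) ⟨
    _ ∎
  where
  open ≡-Reasoning
  X : ℕ → ℕ → ℕ → ℕ → ℕ → ℕ
  X a b u v w = pair a b (φ ∘ (u ∷_)) v w l
  regroup : ∀ p q t u → ((p + q) + 0) + ((t + 0) + (u + 0)) ≡ p + (q + (t + u))
  regroup = solve-∀
... | no z≮y | no z≮x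
  rewrite <ᵇ-false (≮⇒≥ z≮y) | <ᵇ-false (≮⇒≥ z≮x)
    | pair-comm-≤ a b (φ ∘ (x ∷_)) y z l (≮⇒≥ z≮y)
    | pair-comm-≤ (pred a) b (φ ∘ (y ∷_)) x z l (≮⇒≥ z≮x)
    | pair-comm-≤ a (pred b) (φ ∘ (y ∷_)) x z l (≮⇒≥ z≮x) =
  regroup (pair b a (φ ∘ (x ∷_)) y z l) (pair b (pred a) (φ ∘ (y ∷_)) x z l)
    (pair (pred b) a (φ ∘ (y ∷_)) x z l)
  where
  regroup : ∀ p q r → ((p + q) + 0) + ((r + 0) + 0) ≡ ((p + r) + 0) + ((q + 0) + 0)
  regroup = solve-∀

pair-comm-middle a b φ x y l y<x = +-cancelʳ-≡ (pair (pred a) (pred b) φ y x l) _ _ (begin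
  (X (pred a) b + (X a (pred b) + Y a (pred (pred b)))) + Y (pred a) (pred b)
    ≡⟨ xy∙z≈xz∙y (X (pred a) b) _ (Y (pred a) (pred b)) ⟩
  (X (pred a) b + Y (pred a) (pred b)) + (X a (pred b) + Y a (pred (pred b)))
    ≡⟨ cong₂ _+_ (pair-comm-> (pred a) b φ x y l y<x) (pair-comm-> a (pred b) φ x y l y<x) ⟩
  (X b (pred a) + Y b (pred (pred a))) + (X (pred b) a + Y (pred b) (pred a))
    ≡⟨ x∙yz≈yx∙z _ (X (pred b) a) (Y (pred b) (pred a)) ⟩
  (X (pred b) a + (X b (pred a) + Y b (pred (pred a)))) + Y (pred b) (pred a)
    ≡⟨ cong (X (pred b) a + (X b (pred a) + Y b (pred (pred a))) +_)
         (pair-comm-≤ (pred b) (pred a) φ y x l (<⇒≤ y<x)) ⟩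
  (X (pred b) a + (X b (pred a) + Y b (pred (pred a)))) + Y (pred a) (pred b) ∎)
  where
  open ≡-Reasoning
  X Y : ℕ → ℕ → ℕ
  X a b = pair a b φ x y l
  Y a b = pair a b φ y x l

pass : ℕ → (List ℕ → ℕ) → List ℕ → ℕ
pass p φ []      = when (p ≡ᵇ 0) (φ [])
pass p φ (x ∷ l) = carry (suc p) φ x l

pass-cong : ∀ p l → (∀ l′ → l′ ↭ l → φ l′ ≡ ψ l′) → pass p φ l ≡ pass p ψ l
pass-cong p []      eq = cong (when (p ≡ᵇ 0)) (eq _ ↭-refl)
pass-cong p (x ∷ l) eq = carry-cong (suc p) x l eq

pass-comm : ∀ a b φ l → pass a (pass b φ) l ≡ pass b (pass a φ) l
pass-comm a b φ [] with a ≡ᵇ 0 | b ≡ᵇ 0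
... | true  | true  = refl
... | true  | false = refl
... | false | true  = refl
... | false | false = refl
pass-comm a b φ (x ∷ []) with a ≡ᵇ 0 | b ≡ᵇ 0
... | true  | true  = refl
... | true  | false = refl
... | false | true  = refl
... | false | false = refl
pass-comm a b φ (x ∷ y ∷ l) with y <? x
... | yes y<x rewrite <ᵇ-true y<x = pair-comm-> (suc b) (suc a) φ x y l y<x
... | no y≮x rewrite <ᵇ-false (≮⇒≥ y≮x) = cong (_+ 0) (pair-comm-≤ (suc b) (suc a) φ x y l (≮⇒≥ y≮x))

-- Divided differences

infix 4 _≈_

_≈_ : Exponent → Exponent → Set
e ≈ f = ∀ j → expAt e j ≡ expAt f j

expAt-beyond : ∀ e j → len e ≤ j → expAt e j ≡ 0
expAt-beyond []      j       _       = refl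
expAt-beyond (_ ∷ e) (suc j) (s≤s h) = expAt-beyond e j h

allBelow-sound : ∀ k p → allBelow k p ≡ true → ∀ j → j < k → p j ≡ true
allBelow-sound (suc k) p eq j j<1+k with allBelow k p in eq₁ | p k in eq₂
... | true | true with j ≟ k
...   | yes refl = eq₂
...   | no  j≢k  = allBelow-sound k p eq₁ j (≤∧≢⇒< (≤-pred j<1+k) j≢k)

allBelow-complete : ∀ k p → (∀ j → p j ≡ true) → allBelow k p ≡ true
allBelow-complete zero    p h = refl
allBelow-complete (suc k) p h rewrite allBelow-complete k p h = h k

≡ᵇ-refl : ∀ n → (n ≡ᵇ n) ≡ true
≡ᵇ-refl zero    = refl
≡ᵇ-refl (suc n) = ≡ᵇ-refl n

≡ᵇ-sound : ∀ m n → (m ≡ᵇ n) ≡ true → m ≡ n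
≡ᵇ-sound m n eq = ≡ᵇ⇒≡ m n (subst Bool.T (sym eq) _)

expEqᵇ-sound : ∀ e f → expEqᵇ e f ≡ true → e ≈ f
expEqᵇ-sound e f eq j with j <? (len e ⊔ len f)
... | yes j<k = ≡ᵇ-sound _ _ (allBelow-sound _ _ eq j j<k)
... | no  j≮k = trans (expAt-beyond e j (≤-trans (m≤m⊔n (len e) (len f)) (≮⇒≥ j≮k)))
                 (sym (expAt-beyond f j (≤-trans (m≤n⊔m (len e) (len f)) (≮⇒≥ j≮k))))

expEqᵇ-complete : ∀ e f → e ≈ f → expEqᵇ e f ≡ true
expEqᵇ-complete e f h = allBelow-complete (len e ⊔ len f) _ λ j →
  subst (λ n → (expAt e j ≡ᵇ n) ≡ true) (h j) (≡ᵇ-refl (expAt e j))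

expEqᵇ-cong : ∀ e f e′ f′ → (e ≈ f → e′ ≈ f′) → (e′ ≈ f′ → e ≈ f) → expEqᵇ e f ≡ expEqᵇ e′ f′
expEqᵇ-cong e f e′ f′ to from with expEqᵇ e f in eq | expEqᵇ e′ f′ in eq′
... | true  | true  = refl
... | false | false = refl
... | true  | false = trans (sym (expEqᵇ-complete e′ f′ (to (expEqᵇ-sound e f eq)))) eq′
... | false | true  = trans (sym eq) (expEqᵇ-complete e f (from (expEqᵇ-sound e′ f′ eq′)))

-- A divided difference only involves the exponents at `i` and `suc i`. With the others frozen by
-- `e`, a coefficient becomes a function of two numbers `a` and `b`, the form in which `Divided` is
-- stated.
set₂ : ℕ → ℕ → ℕ → Exponent → Exponent
set₂ i a b e = setAt (setAt e i a) (suc i) b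

expAt-setAt : ∀ e i v → expAt (setAt e i v) i ≡ v
expAt-setAt []      zero    v = refl
expAt-setAt []      (suc i) v = expAt-setAt [] i v
expAt-setAt (_ ∷ e) zero    v = refl
expAt-setAt (_ ∷ e) (suc i) v = expAt-setAt e i v

expAt-setAt-≢ : ∀ e i v j → j ≢ i → expAt (setAt e i v) j ≡ expAt e j
expAt-setAt-≢ []      zero    v zero    j≢i = contradiction refl j≢i
expAt-setAt-≢ []      zero    v (suc j) j≢i = refl
expAt-setAt-≢ []      (suc i) v zero    j≢i = refl
expAt-setAt-≢ []      (suc i) v (suc j) j≢i = expAt-setAt-≢ [] i v j (j≢i ∘ cong suc)
expAt-setAt-≢ (_ ∷ e) zero    v zero    j≢i = contradiction refl j≢i
expAt-setAt-≢ (_ ∷ e) zero    v (suc j) j≢i = refl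
expAt-setAt-≢ (_ ∷ e) (suc i) v zero    j≢i = refl
expAt-setAt-≢ (_ ∷ e) (suc i) v (suc j) j≢i = expAt-setAt-≢ e i v j (j≢i ∘ cong suc)

module _ (i a b : ℕ) (e : Exponent) where

  expAt-set₂-fst : expAt (set₂ i a b e) i ≡ a
  expAt-set₂-fst = trans (expAt-setAt-≢ (setAt e i a) (suc i) b i (<⇒≢ ≤-refl)) (expAt-setAt e i a)

  expAt-set₂-snd : expAt (set₂ i a b e) (suc i) ≡ b
  expAt-set₂-snd = expAt-setAt (setAt e i a) (suc i) b

  expAt-set₂-other : ∀ j → j ≢ i → j ≢ suc i → expAt (set₂ i a b e) j ≡ expAt e j
  expAt-set₂-other j j≢i j≢1+i =
    trans (expAt-setAt-≢ (setAt e i a) (suc i) b j j≢1+i) (expAt-setAt-≢ e i a j j≢i)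

record Match (i u v : ℕ) (f : Exponent) (a b : ℕ) (e : Exponent) : Set where
  constructor match
  field
    fst   : u ≡ a
    snd   : v ≡ b
    other : ∀ j → j ≢ i → j ≢ suc i → expAt f j ≡ expAt e j

≈⇒match : ∀ {i u v f a b e} → set₂ i u v f ≈ set₂ i a b e → Match i u v f a b e
≈⇒match {i} {u} {v} {f} {a} {b} {e} h = match
  (trans (sym (expAt-set₂-fst i u v f)) (trans (h i) (expAt-set₂-fst i a b e)))
  (trans (sym (expAt-set₂-snd i u v f)) (trans (h (suc i)) (expAt-set₂-snd i a b e)))
  (λ j p q → trans (sym (expAt-set₂-other i u v f j p q)) (trans (h j) (expAt-set₂-other i a b e j p q)))

match⇒≈ : ∀ {i u v f a b e} → Match i u v f a b e → set₂ i u v f ≈ set₂ i a b e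
match⇒≈ {i} {u} {v} {f} {a} {b} {e} (match refl refl o) j with j ≟ i
... | yes refl = trans (expAt-set₂-fst i u v f) (sym (expAt-set₂-fst i u v e))
... | no j≢i with j ≟ suc i
...   | yes refl = trans (expAt-set₂-snd i u v f) (sym (expAt-set₂-snd i u v e))
...   | no j≢1+i = trans (expAt-set₂-other i u v f j j≢i j≢1+i)
                     (trans (o j j≢i j≢1+i) (sym (expAt-set₂-other i u v e j j≢i j≢1+i)))

set₂-id : ∀ i e → set₂ i (expAt e i) (expAt e (suc i)) e ≈ e
set₂-id i e j with j ≟ i
... | yes refl = expAt-set₂-fst i _ _ e
... | no j≢i with j ≟ suc i
...   | yes refl = expAt-set₂-snd i (expAt e i) _ e
...   | no j≢1+i = expAt-set₂-other i _ _ e j j≢i j≢1+i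

coeff-≈ : ∀ p {e e′} → e ≈ e′ → coeff p e ≡ coeff p e′
coeff-≈ []            h = refl
coeff-≈ ((f , c) ∷ p) {e} {e′} h = cong₂ (λ t r → (if t then c else ℤ.0ℤ) ⊕ r)
  (expEqᵇ-cong f e f e′ (λ k j → trans (k j) (h j)) (λ k j → trans (k j) (sym (h j))))
  (coeff-≈ p h)

coeff-++ : ∀ p q e → coeff (p ++ q) e ≡ coeff p e ⊕ coeff q e
coeff-++ []      q e = sym (ℤ.+-identityˡ _)
coeff-++ ((f , c) ∷ p) q e
  rewrite coeff-++ p q e = sym (ℤ.+-assoc (if expEqᵇ f e then c else ℤ.0ℤ) _ _)

-- The coefficientwise form of f − s f = (x − y) g, with all terms made positive.
record Divided (f g : ℕ → ℕ → ℤ) : Set where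
  field
    edge  : ∀ a → g a 0 ⊕ f 0 (suc a) ≡ f (suc a) 0
    inner : ∀ a b → g a (suc b) ⊕ f (suc b) (suc a) ≡ f (suc a) (suc b) ⊕ g (suc a) b
open Divided

+-cancelʳ-ℤ : ∀ {i j} k → i ⊕ k ≡ j ⊕ k → i ≡ j
+-cancelʳ-ℤ {i} {j} k = ∙-cancelʳ k i j

-- The equation `inner` expresses `g a (suc b)` by `g (suc a) b`, and `edge` gives `g a 0`. Hence
-- the dividend determines the quotient by induction on the second exponent.
divided-unique : ∀ {f f′ g g′} → Divided f g → Divided f′ g′ → (∀ a b → f a b ≡ f′ a b) →
  ∀ b a → g a b ≡ g′ a b
divided-unique {f} {f′} {g} {g′} d d′ eq zero a = +-cancelʳ-ℤ (f 0 (suc a)) (begin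
  g a 0 ⊕ f 0 (suc a)   ≡⟨ edge d a ⟩
  f (suc a) 0           ≡⟨ eq _ _ ⟩
  f′ (suc a) 0          ≡⟨ edge d′ a ⟨
  g′ a 0 ⊕ f′ 0 (suc a) ≡⟨ cong (g′ a 0 ⊕_) (eq _ _) ⟨
  g′ a 0 ⊕ f 0 (suc a)  ∎)
  where open ≡-Reasoning
divided-unique {f} {f′} {g} {g′} d d′ eq (suc b) a = +-cancelʳ-ℤ (f (suc b) (suc a)) (begin
  g a (suc b) ⊕ f (suc b) (suc a)   ≡⟨ inner d a b ⟩
  f (suc a) (suc b) ⊕ g (suc a) b   ≡⟨ cong₂ _⊕_ (eq _ _) (divided-unique d d′ eq b (suc a)) ⟩
  f′ (suc a) (suc b) ⊕ g′ (suc a) b ≡⟨ inner d′ a b ⟨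
  g′ a (suc b) ⊕ f′ (suc b) (suc a) ≡⟨ cong (g′ a (suc b) ⊕_) (eq _ _) ⟨
  g′ a (suc b) ⊕ f (suc b) (suc a)  ∎)
  where open ≡-Reasoning

divided-+ : ∀ {f f′ g g′} → Divided f g → Divided f′ g′ →
  Divided (λ a b → f a b ⊕ f′ a b) (λ a b → g a b ⊕ g′ a b)
divided-+ {f} {f′} {g} {g′} d d′ .edge a = begin
  (g a 0 ⊕ g′ a 0) ⊕ (f 0 (suc a) ⊕ f′ 0 (suc a)) ≡⟨ ℤ-interchange (g a 0) _ _ _ ⟩
  (g a 0 ⊕ f 0 (suc a)) ⊕ (g′ a 0 ⊕ f′ 0 (suc a)) ≡⟨ cong₂ _⊕_ (edge d a) (edge d′ a) ⟩
  f (suc a) 0 ⊕ f′ (suc a) 0                      ∎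
  where open ≡-Reasoning
divided-+ {f} {f′} {g} {g′} d d′ .inner a b = begin
  _ ≡⟨ ℤ-interchange (g a (suc b)) _ _ _ ⟩
  _ ≡⟨ cong₂ _⊕_ (inner d a b) (inner d′ a b) ⟩
  _ ≡⟨ ℤ-interchange (f (suc a) (suc b)) _ _ _ ⟩
  _ ∎
  where open ≡-Reasoning

divided-cong : ∀ {f f′ g g′} → (∀ a b → f a b ≡ f′ a b) → (∀ a b → g a b ≡ g′ a b) →
  Divided f g → Divided f′ g′
divided-cong p q d .edge a = subst₂ _≡_ (cong₂ _⊕_ (q _ _) (p _ _)) (p _ _) (edge d a)
divided-cong p q d .inner a b =
  subst₂ _≡_ (cong₂ _⊕_ (q _ _) (p _ _)) (cong₂ _⊕_ (p _ _) (q _ _)) (inner d a b)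

module _ (i : ℕ) (f e : Exponent) where

  open ≡-Reasoning

  private
    F E : ℕ → ℕ → Exponent
    F u v = set₂ i u v f
    E a b = set₂ i a b e

    matchᵇ : ℕ → ℕ → ℕ → ℕ → Bool
    matchᵇ u v a b = expEqᵇ (F u v) (E a b)

    κ : ℤ → ℕ → ℕ → ℕ → ℕ → ℤ
    κ c u v a b = if matchᵇ u v a b then c else ℤ.0ℤ

    matchᵇ-cong : ∀ u v a b u′ v′ a′ b′ → (u ≡ a → u′ ≡ a′) → (u′ ≡ a′ → u ≡ a) →
      (v ≡ b → v′ ≡ b′) → (v′ ≡ b′ → v ≡ b) → matchᵇ u v a b ≡ matchᵇ u′ v′ a′ b′
    matchᵇ-cong u v a b u′ v′ a′ b′ p p′ q q′ = expEqᵇ-cong (F u v) (E a b) (F u′ v′) (E a′ b′)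
      (λ h → let match x y o = ≈⇒match {i} {u} {v} {f} {a} {b} {e} h in
             match⇒≈ {i} {u′} {v′} {f} {a′} {b′} {e} (match (p x) (q y) o))
      (λ h → let match x y o = ≈⇒match {i} {u′} {v′} {f} {a′} {b′} {e} h in
             match⇒≈ {i} {u} {v} {f} {a} {b} {e} (match (p′ x) (q′ y) o))

    matchᵇ-swap : ∀ u v a b → matchᵇ v u b a ≡ matchᵇ u v a b
    matchᵇ-swap u v a b = expEqᵇ-cong (F v u) (E b a) (F u v) (E a b)
      (λ h → let match x y o = ≈⇒match {i} {v} {u} {f} {b} {a} {e} h in
             match⇒≈ {i} {u} {v} {f} {a} {b} {e} (match y x o))
      (λ h → let match x y o = ≈⇒match {i} {u} {v} {f} {a} {b} {e} h in
             match⇒≈ {i} {v} {u} {f} {b} {a} {e} (match y x o))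

    matchᵇ-≢ : ∀ u v a → matchᵇ u (suc v) a 0 ≡ false
    matchᵇ-≢ u v a with matchᵇ u (suc v) a 0 in eq
    ... | false = refl
    ... | true with () ← Match.snd (≈⇒match {i} {u} {suc v} {f} {a} {0} {e} (expEqᵇ-sound (F u (suc v)) (E a 0) eq))

    κ-swap : ∀ c u v a b → κ c v u b a ≡ κ c u v a b
    κ-swap c u v a b = cong (λ t → if t then c else ℤ.0ℤ) (matchᵇ-swap u v a b)

    κ-suc-fst : ∀ c u v a b → κ c (suc u) v (suc a) b ≡ κ c u v a b
    κ-suc-fst c u v a b = cong (λ t → if t then c else ℤ.0ℤ)
      (matchᵇ-cong (suc u) v (suc a) b u v a b suc-injective (cong suc) id id)

    κ-suc-snd : ∀ c u v a b → κ c u (suc v) a (suc b) ≡ κ c u v a b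
    κ-suc-snd c u v a b = cong (λ t → if t then c else ℤ.0ℤ)
      (matchᵇ-cong u (suc v) a (suc b) u v a b id id suc-injective (cong suc))

    κ-≢ : ∀ c u v a → κ c u (suc v) a 0 ≡ ℤ.0ℤ
    κ-≢ c u v a = cong (λ t → if t then c else ℤ.0ℤ) (matchᵇ-≢ u v a)

    -- Coefficients of the first `n` terms of the geometric sum in `ddTerm`. Times x_i - x_{i+1},
    -- this partial sum telescopes to c (x_i^u x_{i+1}^v - x_i^{u-n} x_{i+1}^{v+n}), which
    -- `row-edge` and `row-inner` record by induction on `n`. At n = u - v the remainder is the
    -- swapped monomial.
    row : ℤ → ℕ → ℕ → ℕ → ℕ → ℕ → ℤ
    row c u v n a b = coeff (map (λ k → set₂ i (u ∸ 1 ∸ k) (v + k) f , c) (upTo n)) (set₂ i a b e)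

    row-suc : ∀ c u v n a b → row c u v (suc n) a b ≡ row c u v n a b ⊕ κ c (u ∸ suc n) (v + n) a b
    row-suc c u v n a b = begin
      row c u v (suc n) a b
        ≡⟨ cong (λ t → coeff (map term t) (E a b)) (upTo-∷ʳ n) ⟨
      coeff (map term (upTo n ++ [ n ])) (E a b)
        ≡⟨ cong (λ t → coeff t (E a b)) (map-++ term (upTo n) [ n ]) ⟩
      coeff (map term (upTo n) ++ [ term n ]) (E a b)
        ≡⟨ coeff-++ (map term (upTo n)) [ term n ] (E a b) ⟩
      row c u v n a b ⊕ (κ c (u ∸ 1 ∸ n) (v + n) a b ⊕ ℤ.0ℤ)
        ≡⟨ cong (row c u v n a b ⊕_) (trans (ℤ.+-identityʳ _)
             (cong (λ t → κ c t (v + n) a b) (∸-+-assoc u 1 n))) ⟩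
      row c u v n a b ⊕ κ c (u ∸ suc n) (v + n) a b ∎
      where
      term : ℕ → Exponent × ℤ
      term k = set₂ i (u ∸ 1 ∸ k) (v + k) f , c

    ∸-suc : ∀ {u n} → suc n ≤ u → u ∸ n ≡ suc (u ∸ suc n)
    ∸-suc {suc u} (s≤s n≤u) = +-∸-assoc 1 n≤u

    row-edge : ∀ c u v n → n ≤ u → ∀ a →
      row c u v n a 0 ⊕ κ c (u ∸ n) (v + n) (suc a) 0 ≡ κ c u v (suc a) 0
    row-edge c u v zero n≤u a rewrite +-identityʳ v = ℤ.+-identityˡ _
    row-edge c u v (suc n) n<u a = begin
      row c u v (suc n) a 0 ⊕ κ c (u ∸ suc n) (v + suc n) (suc a) 0
        ≡⟨ cong₂ _⊕_ (row-suc c u v n a 0)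
             (trans (cong (λ t → κ c (u ∸ suc n) t (suc a) 0) (+-suc v n)) (κ-≢ c (u ∸ suc n) (v + n) (suc a))) ⟩
      (row c u v n a 0 ⊕ κ c (u ∸ suc n) (v + n) a 0) ⊕ ℤ.0ℤ
        ≡⟨ ℤ.+-identityʳ _ ⟩
      row c u v n a 0 ⊕ κ c (u ∸ suc n) (v + n) a 0
        ≡⟨ cong (row c u v n a 0 ⊕_) (trans (sym (κ-suc-fst c _ _ a 0))
             (cong (λ t → κ c t (v + n) (suc a) 0) (sym (∸-suc n<u)))) ⟩
      row c u v n a 0 ⊕ κ c (u ∸ n) (v + n) (suc a) 0
        ≡⟨ row-edge c u v n (<⇒≤ n<u) a ⟩
      κ c u v (suc a) 0 ∎

    row-inner : ∀ c u v n → n ≤ u → ∀ a b →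
      row c u v n a (suc b) ⊕ κ c (u ∸ n) (v + n) (suc a) (suc b) ≡
      κ c u v (suc a) (suc b) ⊕ row c u v n (suc a) b
    row-inner c u v zero n≤u a b rewrite +-identityʳ v = ℤ.+-comm ℤ.0ℤ (κ c u v (suc a) (suc b))
    row-inner c u v (suc n) n<u a b = begin
      row c u v (suc n) a (suc b) ⊕ κ c (u ∸ suc n) (v + suc n) (suc a) (suc b)
        ≡⟨ cong₂ _⊕_ (row-suc c u v n a (suc b))
             (trans (cong (λ t → κ c (u ∸ suc n) t (suc a) (suc b)) (+-suc v n)) (κ-suc-snd c _ _ (suc a) b)) ⟩
      (row c u v n a (suc b) ⊕ κ c (u ∸ suc n) (v + n) a (suc b)) ⊕ κ c (u ∸ suc n) (v + n) (suc a) b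
        ≡⟨ cong (λ t → (row c u v n a (suc b) ⊕ t) ⊕ κ c (u ∸ suc n) (v + n) (suc a) b)
             (trans (sym (κ-suc-fst c _ _ a (suc b)))
             (cong (λ t → κ c t (v + n) (suc a) (suc b)) (sym (∸-suc n<u)))) ⟩
      (row c u v n a (suc b) ⊕ κ c (u ∸ n) (v + n) (suc a) (suc b)) ⊕ κ c (u ∸ suc n) (v + n) (suc a) b
        ≡⟨ cong (_⊕ κ c (u ∸ suc n) (v + n) (suc a) b) (row-inner c u v n (<⇒≤ n<u) a b) ⟩
      (κ c u v (suc a) (suc b) ⊕ row c u v n (suc a) b) ⊕ κ c (u ∸ suc n) (v + n) (suc a) b
        ≡⟨ ℤ.+-assoc (κ c u v (suc a) (suc b)) _ _ ⟩
      κ c u v (suc a) (suc b) ⊕ (row c u v n (suc a) b ⊕ κ c (u ∸ suc n) (v + n) (suc a) b)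
        ≡⟨ cong (κ c u v (suc a) (suc b) ⊕_) (row-suc c u v n (suc a) b) ⟨
      κ c u v (suc a) (suc b) ⊕ row c u v (suc n) (suc a) b ∎

    κ-neg : ∀ c u v a b → κ (ℤ.- c) u v a b ≡ ℤ.- κ c u v a b
    κ-neg c u v a b with matchᵇ u v a b
    ... | true  = refl
    ... | false = refl

    row-end : ∀ c u v → v ≤ u → ∀ a b → κ c (u ∸ (u ∸ v)) (v + (u ∸ v)) a b ≡ κ c u v b a
    row-end c u v v≤u a b = trans
      (cong₂ (λ s t → κ c s t a b) (m∸[m∸n]≡n v≤u) (m+[n∸m]≡n v≤u)) (κ-swap c u v b a)

    divided-> : ∀ c u v → v ≤ u → Divided (κ c u v) (row c u v (u ∸ v))
    divided-> c u v v≤u .edge a = trans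
      (cong (row c u v (u ∸ v) a 0 ⊕_) (sym (row-end c u v v≤u (suc a) 0)))
      (row-edge c u v (u ∸ v) (m∸n≤m u v) a)
    divided-> c u v v≤u .inner a b = trans
      (cong (row c u v (u ∸ v) a (suc b) ⊕_) (sym (row-end c u v v≤u (suc a) (suc b))))
      (row-inner c u v (u ∸ v) (m∸n≤m u v) a b)

    -- Negating a monomial and exchanging its two exponents leaves f - s_i f unchanged, so the
    -- quotient is the one already found for `ℤ.- c` with `v` and `u`.
    divided-≤ : ∀ c u v → u ≤ v → Divided (κ c u v) (row (ℤ.- c) v u (v ∸ u))
    divided-≤ c u v u≤v .edge a = +-cancelʳ-ℤ (κ (ℤ.- c) v u 0 (suc a)) (begin
      (row (ℤ.- c) v u (v ∸ u) a 0 ⊕ κ c u v 0 (suc a)) ⊕ κ (ℤ.- c) v u 0 (suc a)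
        ≡⟨ ℤ-xy∙z≈xz∙y (row (ℤ.- c) v u (v ∸ u) a 0) (κ c u v 0 (suc a)) (κ (ℤ.- c) v u 0 (suc a)) ⟩
      (row (ℤ.- c) v u (v ∸ u) a 0 ⊕ κ (ℤ.- c) v u 0 (suc a)) ⊕ κ c u v 0 (suc a)
        ≡⟨ cong₂ _⊕_ (edge (divided-> (ℤ.- c) v u u≤v) a) (sym (κ-swap c u v 0 (suc a))) ⟩
      κ (ℤ.- c) v u (suc a) 0 ⊕ κ c v u (suc a) 0
        ≡⟨ cancel v u (suc a) 0 ⟩
      ℤ.0ℤ
        ≡⟨ cancel v u 0 (suc a) ⟨
      κ (ℤ.- c) v u 0 (suc a) ⊕ κ c v u 0 (suc a)
        ≡⟨ ℤ.+-comm (κ (ℤ.- c) v u 0 (suc a)) _ ⟩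
      κ c v u 0 (suc a) ⊕ κ (ℤ.- c) v u 0 (suc a)
        ≡⟨ cong (_⊕ κ (ℤ.- c) v u 0 (suc a)) (κ-swap c u v (suc a) 0) ⟩
      κ c u v (suc a) 0 ⊕ κ (ℤ.- c) v u 0 (suc a) ∎)
      where
      cancel : ∀ u v a b → κ (ℤ.- c) u v a b ⊕ κ c u v a b ≡ ℤ.0ℤ
      cancel u v a b rewrite κ-neg c u v a b = ℤ.+-inverseˡ (κ c u v a b)
    divided-≤ c u v u≤v .inner a b = begin
      R a (suc b) ⊕ κ c u v (suc b) (suc a)
        ≡⟨ split (R a (suc b)) (N (suc b) (suc a)) (κ c u v (suc b) (suc a)) ⟩
      ((R a (suc b) ⊕ N (suc b) (suc a)) ⊕ κ c u v (suc b) (suc a)) ℤ.- N (suc b) (suc a)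
        ≡⟨ cong₂ (λ s t → (s ⊕ κ c u v (suc b) (suc a)) ℤ.- t)
             (inner (divided-> (ℤ.- c) v u u≤v) a b) (neg (suc b) (suc a)) ⟩
      ((N (suc a) (suc b) ⊕ R (suc a) b) ⊕ κ c u v (suc b) (suc a)) ℤ.- (ℤ.- κ c u v (suc a) (suc b))
        ≡⟨ cong (λ t → ((t ⊕ R (suc a) b) ⊕ κ c u v (suc b) (suc a)) ℤ.- (ℤ.- κ c u v (suc a) (suc b)))
             (neg (suc a) (suc b)) ⟩
      ((ℤ.- κ c u v (suc b) (suc a) ⊕ R (suc a) b) ⊕ κ c u v (suc b) (suc a)) ℤ.- (ℤ.- κ c u v (suc a) (suc b))
        ≡⟨ join (κ c u v (suc b) (suc a)) (R (suc a) b) (κ c u v (suc a) (suc b)) ⟩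
      κ c u v (suc a) (suc b) ⊕ R (suc a) b ∎
      where
      R N : ℕ → ℕ → ℤ
      R = row (ℤ.- c) v u (v ∸ u)
      N = κ (ℤ.- c) v u
      neg : ∀ a b → N a b ≡ ℤ.- κ c u v b a
      neg a b = trans (κ-neg c v u a b) (cong ℤ.-_ (κ-swap c u v b a))
      split : ∀ r n k → r ⊕ k ≡ ((r ⊕ n) ⊕ k) ℤ.- n
      split = ℤRing.solve-∀
      join : ∀ k r m → ((ℤ.- k ⊕ r) ⊕ k) ℤ.- (ℤ.- m) ≡ m ⊕ r
      join = ℤRing.solve-∀

    κ-coeff : ∀ c a b → κ c (expAt f i) (expAt f (suc i)) a b ≡ coeff ((f , c) ∷ []) (E a b)
    κ-coeff c a b = trans (sym (ℤ.+-identityʳ _)) (cong (λ t → (if t then c else ℤ.0ℤ) ⊕ ℤ.0ℤ)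
      (expEqᵇ-cong (F (expAt f i) (expAt f (suc i))) (E a b) f (E a b)
        (λ h j → trans (sym (set₂-id i f j)) (h j)) (λ h j → trans (set₂-id i f j) (h j))))

  divided-term : ∀ c → Divided (λ a b → coeff ((f , c) ∷ []) (set₂ i a b e))
                               (λ a b → coeff (ddTerm i (f , c)) (set₂ i a b e))
  divided-term c with expAt f (suc i) <ᵇ expAt f i in eq
  ... | true  = divided-cong (κ-coeff c) (λ a b → refl)
    (divided-> c _ _ (<⇒≤ (<ᵇ⇒< (expAt f (suc i)) _ (subst Bool.T (sym eq) _))))
  ... | false = divided-cong (κ-coeff c) (λ a b → refl)
    (divided-≤ c _ _ (≮⇒≥ λ lt → case trans (sym eq) (<ᵇ-true lt) of λ ()))

divided-∂ : ∀ i p e → Divided (λ a b → coeff p (set₂ i a b e)) (λ a b → coeff (∂ i p) (set₂ i a b e))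
divided-∂ i []      e .edge a    = refl
divided-∂ i []      e .inner a b = refl
divided-∂ i (t@(f , c) ∷ p) e = divided-cong
  (λ a b → sym (coeff-++ [ t ] p (set₂ i a b e)))
  (λ a b → sym (coeff-++ (ddTerm i t) (∂ i p) (set₂ i a b e)))
  (divided-+ (divided-term i f e c) (divided-∂ i p e))

-- Schubert polynomials

tailE : Exponent → Exponent
tailE []      = []
tailE (_ ∷ e) = e

expAt-tailE : ∀ e j → expAt (tailE e) j ≡ expAt e (suc j)
expAt-tailE []      j = refl
expAt-tailE (_ ∷ e) j = refl

tailE-≈ : ∀ {e e′} → e ≈ e′ → tailE e ≈ tailE e′
tailE-≈ {e} {e′} h j = trans (expAt-tailE e j) (trans (h (suc j)) (sym (expAt-tailE e′ j)))

-- The passes are made from the last position backwards: the one with e₀ jumps starts at x and comes last.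
pipeCoeff : (List ℕ → ℕ) → List ℕ → Exponent → ℕ
pipeCoeff φ []      e = when (expEqᵇ [] e) (φ [])
pipeCoeff φ (x ∷ l) e = pipeCoeff (carry (suc (expAt e 0)) φ x) l (tailE e)

pipeCoeff-cong : ∀ l e → (∀ l′ → l′ ↭ l → φ l′ ≡ ψ l′) → pipeCoeff φ l e ≡ pipeCoeff ψ l e
pipeCoeff-cong []      e h = cong (when (expEqᵇ [] e)) (h [] ↭-refl)
pipeCoeff-cong (x ∷ l) e h = pipeCoeff-cong l (tailE e) λ l′ l′↭l →
  carry-cong (suc (expAt e 0)) x l′ λ l″ l″↭ → h l″ (↭-trans l″↭ (prep x l′↭l))

pipeCoeff-≈ : ∀ φ l {e e′} → e ≈ e′ → pipeCoeff φ l e ≡ pipeCoeff φ l e′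
pipeCoeff-≈ φ []      {e} {e′} h = cong (λ c → when c (φ [])) (expEqᵇ-cong [] e [] e′
  (λ k j → trans (k j) (h j)) (λ k j → trans (k j) (sym (h j))))
pipeCoeff-≈ φ (x ∷ l) {e} {e′} h rewrite h 0 = pipeCoeff-≈ _ l (tailE-≈ {e} {e′} h)

pipeCoeff-+ : ∀ φ ψ l e → pipeCoeff (λ l′ → φ l′ + ψ l′) l e ≡ pipeCoeff φ l e + pipeCoeff ψ l e
pipeCoeff-+ φ ψ []      e = when-+ (expEqᵇ [] e) _ _
pipeCoeff-+ φ ψ (x ∷ l) e = trans
  (pipeCoeff-cong l (tailE e) λ l′ _ → carry-+ (suc (expAt e 0)) φ ψ x l′)
  (pipeCoeff-+ (carry (suc (expAt e 0)) φ x) (carry (suc (expAt e 0)) ψ x) l (tailE e))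

pipeCoeff-zero : ∀ l e → pipeCoeff (λ _ → 0) l e ≡ 0
pipeCoeff-zero []      e = when-0 (expEqᵇ [] e)
pipeCoeff-zero (x ∷ l) e = trans (pipeCoeff-cong l (tailE e) λ l′ _ → carry-zero (suc (expAt e 0)) x l′)
  (pipeCoeff-zero l (tailE e))

pipeCoeff-when : ∀ c φ l e → pipeCoeff (λ l′ → when c (φ l′)) l e ≡ when c (pipeCoeff φ l e)
pipeCoeff-when true  φ l e = refl
pipeCoeff-when false φ l e = pipeCoeff-zero l e

data Ascent : ℕ → List ℕ → List ℕ → Set where
  here  : ∀ {x y l} → x < y → Ascent 0 (x ∷ y ∷ l) (y ∷ x ∷ l)
  there : ∀ {i x l l′} → Ascent i l l′ → Ascent (suc i) (x ∷ l) (x ∷ l′)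

expAt-set₂-suc : ∀ i a b e → expAt (set₂ (suc i) a b e) 0 ≡ expAt e 0
expAt-set₂-suc i a b []      = refl
expAt-set₂-suc i a b (_ ∷ e) = refl

tailE-set₂-suc : ∀ i a b e → tailE (set₂ (suc i) a b e) ≡ set₂ i a b (tailE e)
tailE-set₂-suc i a b []      = refl
tailE-set₂-suc i a b (_ ∷ e) = refl

pipeCoeff-set₂-0 : ∀ φ x y l a b e →
  pipeCoeff φ (x ∷ y ∷ l) (set₂ 0 a b e) ≡ pipeCoeff (pair (suc a) (suc b) φ x y) l (tailE (tailE e))
pipeCoeff-set₂-0 φ x y l a b []          = refl
pipeCoeff-set₂-0 φ x y l a b (_ ∷ [])    = refl
pipeCoeff-set₂-0 φ x y l a b (_ ∷ _ ∷ e) = refl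

pipeCoeff-set₂-suc : ∀ i φ x l a b e →
  pipeCoeff φ (x ∷ l) (set₂ (suc i) a b e) ≡ pipeCoeff (carry (suc (expAt e 0)) φ x) l (set₂ i a b (tailE e))
pipeCoeff-set₂-suc i φ x l a b e
  rewrite expAt-set₂-suc i a b e | tailE-set₂-suc i a b e = refl

-- Positions before `i` only change the weight, and those after `i + 1` are common to both sides.
-- What remains is `pair-comm->` for the descending pair. There `pair-comm-≤` exchanges the two
-- exponents of the ascending pair, reflecting that ∂_i f is symmetric in x_i and x_{i+1}.
divided-pipeCoeff : ∀ {i l l′} → Ascent i l l′ → ∀ φ e →
  Divided (λ a b → ℤ.+ pipeCoeff φ l′ (set₂ i a b e)) (λ a b → ℤ.+ pipeCoeff φ l (set₂ i a b e))
divided-pipeCoeff {suc i} {x ∷ l} {_ ∷ l′} (there asc) φ e = divided-cong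
  (λ a b → cong ℤ.+_ (sym (pipeCoeff-set₂-suc i φ x l′ a b e)))
  (λ a b → cong ℤ.+_ (sym (pipeCoeff-set₂-suc i φ x l a b e)))
  (divided-pipeCoeff asc (carry (suc (expAt e 0)) φ x) (tailE e))
divided-pipeCoeff {l = x ∷ y ∷ l} (here x<y) φ e = divided-cong
  (λ a b → cong ℤ.+_ (sym (pipeCoeff-set₂-0 φ y x l a b e)))
  (λ a b → cong ℤ.+_ (sym (pipeCoeff-set₂-0 φ x y l a b e)))
  divided-pair
  where
  open ≡-Reasoning
  G F : ℕ → ℕ → List ℕ → ℕ
  G a b = pair (suc a) (suc b) φ x y
  F a b = pair (suc a) (suc b) φ y x
  r = tailE (tailE e)
  G-comm : ∀ a b l′ → G a b l′ ≡ G b a l′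
  G-comm a b l′ = pair-comm-≤ (suc a) (suc b) φ x y l′ (<⇒≤ x<y)
  divided-pair : Divided (λ a b → ℤ.+ pipeCoeff (F a b) l r) (λ a b → ℤ.+ pipeCoeff (G a b) l r)
  divided-pair .Divided.edge a = cong ℤ.+_ (begin
    pipeCoeff (G a 0) l r + pipeCoeff (F 0 (suc a)) l r ≡⟨ pipeCoeff-+ (G a 0) (F 0 (suc a)) l r ⟨
    pipeCoeff (λ l′ → G a 0 l′ + F 0 (suc a) l′) l r    ≡⟨ pipeCoeff-cong l r (λ l′ _ → eq l′) ⟩
    pipeCoeff (F (suc a) 0) l r                                   ∎)
    where
    eq : ∀ l′ → G a 0 l′ + F 0 (suc a) l′ ≡ F (suc a) 0 l′
    eq l′ = begin
      G a 0 l′ + F 0 (suc a) l′   ≡⟨ +-comm (G a 0 l′) _ ⟩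
      F 0 (suc a) l′ + G a 0 l′   ≡⟨ cong (F 0 (suc a) l′ +_) (G-comm a 0 l′) ⟩
      F 0 (suc a) l′ + G 0 a l′   ≡⟨ pair-comm-> (2 + a) 1 φ y x l′ x<y ⟨
      -- The shifted index 0 would stand for -1 jumps, so this summand vanishes. This accounts for
      -- the separate shape of `edge`.
      F (suc a) 0 l′ + pair (2 + a) 0 φ x y l′
        ≡⟨ cong (F (suc a) 0 l′ +_) (carry-0 _ y l′) ⟩
      F (suc a) 0 l′ + 0          ≡⟨ +-identityʳ _ ⟩
      F (suc a) 0 l′              ∎
  divided-pair .Divided.inner a b = cong ℤ.+_ (begin
    pipeCoeff (G a (suc b)) l r + pipeCoeff (F (suc b) (suc a)) l r
      ≡⟨ pipeCoeff-+ (G a (suc b)) (F (suc b) (suc a)) l r ⟨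
    pipeCoeff (λ l′ → G a (suc b) l′ + F (suc b) (suc a) l′) l r
      ≡⟨ pipeCoeff-cong l r (λ l′ _ → eq l′) ⟩
    pipeCoeff (λ l′ → F (suc a) (suc b) l′ + G (suc a) b l′) l r
      ≡⟨ pipeCoeff-+ (F (suc a) (suc b)) (G (suc a) b) l r ⟩
    pipeCoeff (F (suc a) (suc b)) l r + pipeCoeff (G (suc a) b) l r ∎)
    where
    eq : ∀ l′ → G a (suc b) l′ + F (suc b) (suc a) l′ ≡ F (suc a) (suc b) l′ + G (suc a) b l′
    eq l′ = begin
      G a (suc b) l′ + F (suc b) (suc a) l′ ≡⟨ +-comm (G a (suc b) l′) _ ⟩
      F (suc b) (suc a) l′ + G a (suc b) l′ ≡⟨ cong (F (suc b) (suc a) l′ +_) (G-comm a (suc b) l′) ⟩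
      F (suc b) (suc a) l′ + G (suc b) a l′ ≡⟨ pair-comm-> (2 + a) (2 + b) φ y x l′ x<y ⟨
      F (suc a) (suc b) l′ + G (suc a) b l′ ∎

-- The decreasing word: base of the recursion

sorted : List ℕ → ℕ
sorted []      = 1
sorted (x ∷ l) = when (all (x ≤ᵇ_) l) (sorted l)

≤ᵇ-true : ∀ {x y} → x ≤ y → (x ≤ᵇ y) ≡ true
≤ᵇ-true {x} {y} x≤y with x ≤ᵇ y | ≤⇒≤ᵇ x≤y
... | true | _ = refl

≤ᵇ-false : ∀ {x y} → y < x → (x ≤ᵇ y) ≡ false
≤ᵇ-false {x} {y} y<x with x ≤ᵇ y in eq
... | false = refl
... | true  = contradiction (≤ᵇ⇒≤ x y (subst Bool.T (sym eq) _)) (<⇒≱ y<x)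

all-≤ᵇ-true : ∀ {x l} → All (x ≤_) l → all (x ≤ᵇ_) l ≡ true
all-≤ᵇ-true []          = refl
all-≤ᵇ-true (x≤y ∷ x≤l) rewrite ≤ᵇ-true x≤y = all-≤ᵇ-true x≤l

sorted-descent : ∀ k {x z} l → z < x → sorted (k ++ x ∷ z ∷ l) ≡ 0
sorted-descent []      l z<x rewrite ≤ᵇ-false z<x = refl
sorted-descent (y ∷ k) l z<x rewrite sorted-descent k l z<x = when-0 (all (y ≤ᵇ_) (k ++ _ ∷ _ ∷ l))

sorted-∷ʳ : ∀ {x} l → All (_< x) l → sorted (l ++ [ x ]) ≡ sorted l
sorted-∷ʳ []      []          = refl
sorted-∷ʳ {x} (y ∷ l) (y<x ∷ l<x) = cong₂ when (all-∷ʳ l) (sorted-∷ʳ l l<x)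
  where
  all-∷ʳ : ∀ l → all (y ≤ᵇ_) (l ++ [ x ]) ≡ all (y ≤ᵇ_) l
  all-∷ʳ []      rewrite ≤ᵇ-true (<⇒≤ y<x) = refl
  all-∷ʳ (z ∷ l) = cong ((y ≤ᵇ z) ∧_) (all-∷ʳ l)

-- If `x` is dropped before the end, it stays directly in front of a smaller entry, and `φ` vanishes
-- there. Only the pass that jumps over all of `l` survives.
carry-max : ∀ p φ x l → (∀ k z l → z < x → φ (k ++ x ∷ z ∷ l) ≡ 0) → All (_< x) l →
  carry (suc p) φ x l ≡ when (p ≡ᵇ length l) (φ (l ++ [ x ]))
carry-max p φ x []      h []            = refl
carry-max p φ x (y ∷ l) h (y<x ∷ l<x) rewrite <ᵇ-true y<x = cong₂ _+_ drop (jump p)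
  where
  drop : carry (suc p) (φ ∘ (x ∷_)) y l ≡ 0
  drop = trans (carry-cong (suc p) y l vanish) (carry-zero (suc p) y l)
    where
    vanish : ∀ l′ → l′ ↭ y ∷ l → φ (x ∷ l′) ≡ 0
    vanish []       r = contradiction (↭-sym r) ¬x∷xs↭[]
    vanish (z ∷ l′) r = h [] z l′ (All.head (All-resp-↭ (↭-sym r) (y<x ∷ l<x)))
  jump : ∀ p → carry p (φ ∘ (y ∷_)) x l ≡ when (p ≡ᵇ suc (length l)) (φ (y ∷ l ++ [ x ]))
  jump zero    = carry-0 _ x l
  jump (suc p) = carry-max p (φ ∘ (y ∷_)) x l (λ k → h (y ∷ k)) l<x

expEqᵇ-∷ : ∀ k s e → expEqᵇ (k ∷ s) e ≡ (expAt e 0 ≡ᵇ k) ∧ expEqᵇ s (tailE e)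
expEqᵇ-∷ k s e with expAt e 0 ≡ᵇ k in eq
... | true = expEqᵇ-cong (k ∷ s) e s (tailE e)
  (λ h j → trans (h (suc j)) (sym (expAt-tailE e j)))
  (λ { h zero    → sym (≡ᵇ-sound _ k eq)
     ; h (suc j) → trans (h j) (expAt-tailE e j) })
... | false with expEqᵇ (k ∷ s) e in eq′
...   | false = refl
...   | true = trans (sym (subst (λ n → (n ≡ᵇ k) ≡ true) (expEqᵇ-sound (k ∷ s) e eq′ 0) (≡ᵇ-refl k))) eq

when-∧ : ∀ c d n → when (c ∧ d) n ≡ when c (when d n)
when-∧ true  d n = refl
when-∧ false d n = refl

-- Every pass starts at an entry exceeding all later ones, so `carry-max` forces it to jump over all
-- of them. The forced numbers of jumps form the staircase.
pipeCoeff-decreasing : ∀ l e → AllPairs _>_ l → pipeCoeff sorted l e ≡ when (expEqᵇ (stairs (length l)) e) 1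
pipeCoeff-decreasing []      e []        = refl
pipeCoeff-decreasing (x ∷ l) e (x>l ∷ d) = begin
  pipeCoeff (carry (suc e₀) sorted x) l (tailE e)
    ≡⟨ pipeCoeff-cong l (tailE e) carry-sorted ⟩
  pipeCoeff (λ l′ → when (e₀ ≡ᵇ length l) (sorted l′)) l (tailE e)
    ≡⟨ pipeCoeff-when (e₀ ≡ᵇ length l) sorted l (tailE e) ⟩
  when (e₀ ≡ᵇ length l) (pipeCoeff sorted l (tailE e))
    ≡⟨ cong (when (e₀ ≡ᵇ length l)) (pipeCoeff-decreasing l (tailE e) d) ⟩
  when (e₀ ≡ᵇ length l) (when (expEqᵇ (stairs (length l)) (tailE e)) 1)
    ≡⟨ when-∧ (e₀ ≡ᵇ length l) _ 1 ⟨
  when ((e₀ ≡ᵇ length l) ∧ expEqᵇ (stairs (length l)) (tailE e)) 1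
    ≡⟨ cong (λ c → when c 1) (expEqᵇ-∷ (length l) (stairs (length l)) e) ⟨
  when (expEqᵇ (stairs (suc (length l))) e) 1 ∎
  where
  open ≡-Reasoning
  e₀ = expAt e 0
  carry-sorted : ∀ l′ → l′ ↭ l → carry (suc e₀) sorted x l′ ≡ when (e₀ ≡ᵇ length l) (sorted l′)
  carry-sorted l′ r rewrite sym (↭-length r) = trans
    (carry-max e₀ sorted x l′ (λ k z l z<x → sorted-descent k l z<x) (All-resp-↭ (↭-sym r) x>l))
    (cong (when (e₀ ≡ᵇ length l′)) (sorted-∷ʳ l′ (All-resp-↭ (↭-sym r) x>l)))

Ascent⇒↭ : ∀ {i l l′} → Ascent i l l′ → l ↭ l′
Ascent⇒↭ (here _)    = swap _ _ ↭-refl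
Ascent⇒↭ (there asc) = prep _ (Ascent⇒↭ asc)

Ascent-Unique : ∀ {i l l′} → Ascent i l l′ → Unique l → Unique l′
Ascent-Unique (here _)    ((x≢y ∷ x≢l) ∷ y≢l ∷ u) = ((x≢y ∘ sym) ∷ y≢l) ∷ x≢l ∷ u
Ascent-Unique (there asc) (x≢l ∷ u) = All-resp-↭ (Ascent⇒↭ asc) x≢l ∷ Ascent-Unique asc u

-- Non-inversions as the measure of the recursion

larger : ℕ → List ℕ → ℕ
larger x []      = 0
larger x (y ∷ l) = when (x <ᵇ y) 1 + larger x l

noninversions : List ℕ → ℕ
noninversions []      = 0
noninversions (x ∷ l) = larger x l + noninversions l

larger-Ascent : ∀ {i l l′} x → Ascent i l l′ → larger x l ≡ larger x l′
larger-Ascent x (here {y} {z} {l} _) = x∙yz≈y∙xz (when (x <ᵇ y) 1) (when (x <ᵇ z) 1) (larger x l)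
larger-Ascent x (there {x = y} asc) = cong (when (x <ᵇ y) 1 +_) (larger-Ascent x asc)

noninversions-Ascent : ∀ {i l l′} → Ascent i l l′ → noninversions l ≡ suc (noninversions l′)
noninversions-Ascent (here {x} {y} {l} x<y)
  rewrite <ᵇ-true x<y | <ᵇ-false (<⇒≤ x<y) = cong suc (x∙yz≈y∙xz (larger x l) (larger y l) (noninversions l))
noninversions-Ascent (there {x = x} {l′ = l′} asc) = trans
  (cong₂ _+_ (larger-Ascent x asc) (noninversions-Ascent asc)) (+-suc (larger x l′) _)

larger-≤ : ∀ x l → larger x l ≤ length l
larger-≤ x []      = z≤n
larger-≤ x (y ∷ l) with x <ᵇ y
... | true  = s≤s (larger-≤ x l)
... | false = m≤n⇒m≤1+n (larger-≤ x l)

noninversions-≤ : ∀ l → noninversions l ≤ length l * length l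
noninversions-≤ []      = z≤n
noninversions-≤ (x ∷ l) = ≤-trans (+-mono-≤ (larger-≤ x l) (noninversions-≤ l))
  (≤-trans (+-monoʳ-≤ n (*-monoʳ-≤ n (n≤1+n n))) (n≤1+n _))
  where n = length l

noninversions-< : ∀ l → 1 ≤ length l → noninversions l < length l * length l
noninversions-< (x ∷ l) _ = s≤s (≤-trans (+-mono-≤ (larger-≤ x l) (noninversions-≤ l))
  (+-monoʳ-≤ n (*-monoʳ-≤ n (n≤1+n n))))
  where n = length l

firstAscentFrom-just : ∀ k i u {j} → firstAscentFrom k i u ≡ just j → (j < i + k) × (u j < u (suc j))
firstAscentFrom-just (suc k) i u eq with u i <ᵇ u (suc i) in lt
firstAscentFrom-just (suc k) i u refl | true =
  m<m+n i z<s , <ᵇ⇒< (u i) _ (subst Bool.T (sym lt) _)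
firstAscentFrom-just (suc k) i u eq | false with j< , asc ← firstAscentFrom-just k (suc i) u eq =
  ≤-trans j< (≤-reflexive (sym (+-suc i k))) , asc

firstAscentFrom-nothing : ∀ k i u → firstAscentFrom k i u ≡ nothing →
  ∀ {j} → j < k → u (suc (i + j)) ≤ u (i + j)
firstAscentFrom-nothing (suc k) i u eq j<k with u i <ᵇ u (suc i) in lt
firstAscentFrom-nothing (suc k) i u eq {zero} j<k | false rewrite +-identityʳ i =
  ≮⇒≥ λ i<1+i → case trans (sym lt) (<ᵇ-true i<1+i) of λ ()
firstAscentFrom-nothing (suc k) i u eq {suc j} (s≤s j<k) | false
  rewrite +-suc i j = firstAscentFrom-nothing k (suc i) u eq j<k

ascent : ∀ i N u → suc i < N → u i < u (suc i) → Ascent i (applyUpTo u N) (applyUpTo (swapPos u i) N)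
ascent zero    (suc zero)    u (s≤s ()) lt
ascent zero    (suc (suc N)) u _        lt = here lt
ascent (suc i) (suc N)       u (s≤s i<) lt = there (ascent i N (u ∘ suc) i< lt)

decreasing : ∀ {l} → Linked _≥_ l → Unique l → Linked _>_ l
decreasing []          u               = []
decreasing [-]         u               = [-]
decreasing (x≥y ∷ lnk) ((x≢y ∷ _) ∷ u) = ≤∧≢⇒< x≥y (x≢y ∘ sym) ∷ decreasing lnk u

-- Both sides are quotients in the sense of `Divided`, and by induction their dividends agree, so
-- `divided-unique` applies. Swapping an ascent removes exactly one non-inversion, which pays for
-- one unit of fuel.
coeff-schubFuel : ∀ N fuel u → noninversions (applyUpTo u N) < fuel → Unique (applyUpTo u N) →
  ∀ e → coeff (schubFuel N fuel u) e ≡ ℤ.+ pipeCoeff sorted (applyUpTo u N) e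
coeff-schubFuel N (suc fuel) u enough unique e with firstAscent N u in eq
... | nothing = begin
  (if expEqᵇ (stairs N) e then ℤ.1ℤ else ℤ.0ℤ) ⊕ ℤ.0ℤ
    ≡⟨ ℤ.+-identityʳ _ ⟩
  (if expEqᵇ (stairs N) e then ℤ.1ℤ else ℤ.0ℤ)
    ≡⟨ if-+ (expEqᵇ (stairs N) e) ⟩
  ℤ.+ when (expEqᵇ (stairs N) e) 1
    ≡⟨ cong (λ k → ℤ.+ when (expEqᵇ (stairs k) e) 1) (length-applyUpTo u N) ⟨
  ℤ.+ when (expEqᵇ (stairs (length (applyUpTo u N))) e) 1
    ≡⟨ cong ℤ.+_ (pipeCoeff-decreasing (applyUpTo u N) e (Linked.Linked⇒AllPairs (λ p q → <-trans q p)
         (decreasing (Linked.applyUpTo⁺₁ u N λ i< →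
           firstAscentFrom-nothing (N ∸ 1) 0 u eq (∸-monoˡ-≤ 1 i<)) unique))) ⟨
  ℤ.+ pipeCoeff sorted (applyUpTo u N) e ∎
  where
  open ≡-Reasoning
  if-+ : ∀ c → (if c then ℤ.1ℤ else ℤ.0ℤ) ≡ ℤ.+ when c 1
  if-+ true  = refl
  if-+ false = refl
... | just i = begin
  coeff (∂ i P) e
    ≡⟨ coeff-≈ (∂ i P) (set₂-id i e) ⟨
  coeff (∂ i P) (set₂ i a b e)
    ≡⟨ divided-unique (divided-∂ i P e) (divided-pipeCoeff asc sorted e) (λ a b → IH (set₂ i a b e)) b a ⟩
  ℤ.+ pipeCoeff sorted (applyUpTo u N) (set₂ i a b e)
    ≡⟨ cong ℤ.+_ (pipeCoeff-≈ sorted (applyUpTo u N) (set₂-id i e)) ⟩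
  ℤ.+ pipeCoeff sorted (applyUpTo u N) e ∎
  where
  open ≡-Reasoning
  a = expAt e i
  b = expAt e (suc i)
  P = schubFuel N fuel (swapPos u i)
  ascᵤ = firstAscentFrom-just (N ∸ 1) 0 u eq
  1+i<N : ∀ N → i < N ∸ 1 → suc i < N
  1+i<N (suc N) i<N = s≤s i<N
  asc : Ascent i (applyUpTo u N) (applyUpTo (swapPos u i) N)
  asc = ascent i N u (1+i<N N (proj₁ ascᵤ)) (proj₂ ascᵤ)
  IH : ∀ e → coeff P e ≡ ℤ.+ pipeCoeff sorted (applyUpTo (swapPos u i) N) e
  IH = coeff-schubFuel N fuel (swapPos u i)
    (≤-pred (subst (_< suc fuel) (noninversions-Ascent asc) enough)) (Ascent-Unique asc unique)

coeff-schubert : ∀ N u → 1 ≤ N → Unique (applyUpTo u N) →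
  ∀ e → coeff (schubert N u) e ≡ ℤ.+ pipeCoeff sorted (applyUpTo u N) e
coeff-schubert N u 1≤N unique = coeff-schubFuel N (N * N) u
  (subst (λ k → noninversions (applyUpTo u N) < k * k) (length-applyUpTo u N)
    (noninversions-< (applyUpTo u N) (subst (1 ≤_) (sym (length-applyUpTo u N)) 1≤N))) unique

-- Stabilisation of the coefficients

-- The fixed points that 1^t × w puts in front of w are minima of what follows them. This is the
-- property of a weight that allows such entries to be discarded.
Strippable : (List ℕ → ℕ) → Set
Strippable φ = ∀ {x l} → All (x ≤_) l → φ (x ∷ l) ≡ φ l

sorted-strippable : Strippable sorted
sorted-strippable x≤l rewrite all-≤ᵇ-true x≤l = refl

-- A minimum in hand cannot jump over anything, so it is dropped at once and the pass goes on as if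
-- it had started at the next entry.
pass-strippable : ∀ p → Strippable φ → Strippable (pass p φ)
pass-strippable p s {x} {l} x≤l = trans (drop l x≤l)
  (pass-cong p l λ l′ r → s (All-resp-↭ (↭-sym r) x≤l))
  where
  drop : ∀ {x φ} l → All (x ≤_) l → pass p φ (x ∷ l) ≡ pass p (φ ∘ (x ∷_)) l
  drop []      []        = refl
  drop (y ∷ l) (x≤y ∷ _) rewrite <ᵇ-false x≤y = +-identityʳ _

passes : (List ℕ → ℕ) → List ℕ → List ℕ → ℕ
passes φ []      = φ
passes φ (p ∷ e) = passes (pass p φ) e

pipeCoeff-[] : ∀ φ l → pipeCoeff φ l [] ≡ φ l
pipeCoeff-[] φ []      = refl
pipeCoeff-[] φ (x ∷ l) = trans (pipeCoeff-[] (carry 1 φ x) l) (carry-1 φ x l)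

-- A pass starting inside the prefix of minima acts as a full pass on the rest. Since
-- `length e ≤ t`, all passes that jump start there, so the starting positions no longer restrict
-- them. This is why the coefficient stabilises.
pipeCoeff-strip : ∀ t u n e → Strippable φ → length e ≤ t → (∀ {i j} → i < t → i < j → u i ≤ u j) →
  pipeCoeff φ (applyUpTo u (t + n)) e ≡ passes φ e (applyUpTo (λ j → u (t + j)) n)
pipeCoeff-strip {φ} zero    u n []      s _ _ = pipeCoeff-[] φ _
pipeCoeff-strip {φ} (suc t) u n []      s _ m = begin
  pipeCoeff φ (applyUpTo u (suc t + n)) []
    ≡⟨ pipeCoeff-[] φ (applyUpTo u (suc t + n)) ⟩
  φ (applyUpTo u (suc t + n))
    ≡⟨ s (All.applyUpTo⁺₂ (u ∘ suc) (t + n) λ i → m z<s z<s) ⟩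
  φ (applyUpTo (u ∘ suc) (t + n))
    ≡⟨ pipeCoeff-[] φ (applyUpTo (u ∘ suc) (t + n)) ⟨
  pipeCoeff φ (applyUpTo (u ∘ suc) (t + n)) []
    ≡⟨ pipeCoeff-strip t (u ∘ suc) n [] s z≤n (λ p q → m (s≤s p) (s≤s q)) ⟩
  φ (applyUpTo (λ j → u (suc t + j)) n) ∎
  where open ≡-Reasoning
pipeCoeff-strip {φ} (suc t) u n (p ∷ e) s (s≤s e≤t) m = trans
  (pipeCoeff-cong (applyUpTo (u ∘ suc) (t + n)) e λ l′ r →
    pass-strippable p s (All-resp-↭ (↭-sym r) (All.applyUpTo⁺₂ (u ∘ suc) (t + n) λ i → m z<s z<s)))
  (pipeCoeff-strip t (u ∘ suc) n e (pass-strippable p s) e≤t (λ p q → m (s≤s p) (s≤s q)))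

+-<ᵇ : ∀ t x y → (t + x <ᵇ t + y) ≡ (x <ᵇ y)
+-<ᵇ zero    x y = refl
+-<ᵇ (suc t) x y = +-<ᵇ t x y

+-≤ᵇ : ∀ t x y → (t + x ≤ᵇ t + y) ≡ (x ≤ᵇ y)
+-≤ᵇ t x y with x ≤? y
... | yes x≤y = trans (≤ᵇ-true (+-monoʳ-≤ t x≤y)) (sym (≤ᵇ-true x≤y))
... | no  x≰y = trans (≤ᵇ-false (+-monoʳ-< t (≰⇒> x≰y))) (sym (≤ᵇ-false (≰⇒> x≰y)))

carry-shift : ∀ t p φ x l → carry p φ (t + x) (map (t +_) l) ≡ carry p (φ ∘ map (t +_)) x l
carry-shift t p φ x []      = refl
carry-shift t p φ x (y ∷ l)
  rewrite +-<ᵇ t y x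
        | carry-shift t p (φ ∘ (t + x ∷_)) y l
        | carry-shift t (pred p) (φ ∘ (t + y ∷_)) x l = refl

pass-shift : ∀ t p φ l → pass p φ (map (t +_) l) ≡ pass p (φ ∘ map (t +_)) l
pass-shift t p φ []      = refl
pass-shift t p φ (x ∷ l) = carry-shift t (suc p) φ x l

sorted-shift : ∀ t l → sorted (map (t +_) l) ≡ sorted l
sorted-shift t []      = refl
sorted-shift t (x ∷ l) = cong₂ when (all-shift l) (sorted-shift t l)
  where
  all-shift : ∀ l → all (t + x ≤ᵇ_) (map (t +_) l) ≡ all (x ≤ᵇ_) l
  all-shift []      = refl
  all-shift (y ∷ l) = cong₂ _∧_ (+-≤ᵇ t x y) (all-shift l)

passes-shift : ∀ t e → (∀ l → φ (map (t +_) l) ≡ φ l) →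
  ∀ l → passes φ e (map (t +_) l) ≡ passes φ e l
passes-shift     t []      h l = h l
passes-shift {φ} t (p ∷ e) h l = passes-shift t e
  (λ l → trans (pass-shift t p φ l) (pass-cong p l λ l′ _ → h l′)) l

-- In `passes` the first exponent belongs to the pass made last. Commutation reverses the order, so
-- that induction on the exponent vector can apply its first pass to the word itself.
passes-foldr : ∀ φ e l → passes φ e l ≡ foldr pass φ e l
passes-foldr φ []      l = refl
passes-foldr φ (p ∷ e) l = trans (passes-foldr (pass p φ) e l) (foldr-pass e l)
  where
  foldr-pass : ∀ e l → foldr pass (pass p φ) e l ≡ pass p (foldr pass φ e) l
  foldr-pass []      l = refl
  foldr-pass (q ∷ e) l = trans (pass-cong q l λ l′ _ → foldr-pass e l′) (pass-comm q p (foldr pass φ e) l)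

module _ {n : ℕ} (w : Permutation′ n) where

  open ≡-Reasoning

  word : List ℕ
  word = applyUpTo (oneLine w) n

  oneLine-injective : ∀ {i j} → i < n → j < n → oneLine w i ≡ oneLine w j → i ≡ j
  oneLine-injective {i} {j} i<n j<n eq with i <? n | j <? n
  ... | no i≮n | _      = contradiction i<n i≮n
  ... | _      | no j≮n = contradiction j<n j≮n
  ... | yes p  | yes q  = begin
    i                     ≡⟨ Fin.toℕ-fromℕ< p ⟨
    Fin.toℕ (fromℕ< p)    ≡⟨ cong Fin.toℕ (begin
      fromℕ< p                              ≡⟨ inverseˡ w ⟨
      w ⟨$⟩ˡ (w ⟨$⟩ʳ fromℕ< p)              ≡⟨ cong (w ⟨$⟩ˡ_) (Fin.toℕ-injective eq) ⟩
      w ⟨$⟩ˡ (w ⟨$⟩ʳ fromℕ< q)              ≡⟨ inverseˡ w ⟩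
      fromℕ< q                              ∎) ⟩
    Fin.toℕ (fromℕ< q)    ≡⟨ Fin.toℕ-fromℕ< q ⟩
    j                     ∎

  shiftPerm-< : ∀ {t j} → j < t → shiftPerm t w j ≡ j
  shiftPerm-< j<t rewrite <ᵇ-true j<t = refl

  shiftPerm-≥ : ∀ {t j} → t ≤ j → shiftPerm t w j ≡ t + oneLine w (j ∸ t)
  shiftPerm-≥ t≤j rewrite <ᵇ-false t≤j = refl

  shiftPerm-prefix : ∀ {t i j} → i < t → i < j → shiftPerm t w i < shiftPerm t w j
  shiftPerm-prefix {t} {i} {j} i<t i<j rewrite shiftPerm-< i<t with j <? t
  ... | yes j<t rewrite shiftPerm-< j<t = i<j
  ... | no  j≮t rewrite shiftPerm-≥ (≮⇒≥ j≮t) = ≤-trans i<t (m≤m+n t _)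

  shiftPerm-≢ : ∀ t {i j} → i < j → j < t + n → shiftPerm t w i ≢ shiftPerm t w j
  shiftPerm-≢ t {i} {j} i<j j<t+n with i <? t
  ... | yes i<t = <⇒≢ (shiftPerm-prefix i<t i<j)
  ... | no  i≮t rewrite shiftPerm-≥ (≮⇒≥ i≮t) | shiftPerm-≥ (≤-trans (≮⇒≥ i≮t) (<⇒≤ i<j)) = λ eq →
    <⇒≢ i<j (∸-cancelʳ-≡ t≤i t≤j (oneLine-injective (below t≤i (<-trans i<j j<t+n)) (below t≤j j<t+n)
      (+-cancelˡ-≡ t _ _ eq)))
    where
    t≤i = ≮⇒≥ i≮t
    t≤j = ≤-trans t≤i (<⇒≤ i<j)
    below : ∀ {k} → t ≤ k → k < t + n → k ∸ t < n
    below {k} t≤k k<t+n = subst (k ∸ t <_) (m+n∸m≡n t n) (∸-monoˡ-< k<t+n t≤k)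

  coeff-schubShift : 1 ≤ n → ∀ e t → length e ≤ t → coeff (schubShift t w) e ≡ ℤ.+ foldr pass sorted e word
  coeff-schubShift 1≤n e t e≤t = trans
    (coeff-schubert (t + n) (shiftPerm t w) (≤-trans 1≤n (m≤n+m n t))
      (Unique.applyUpTo⁺₁ (shiftPerm t w) (t + n) (shiftPerm-≢ t)) e)
    (cong ℤ.+_ (begin
      pipeCoeff sorted (applyUpTo (shiftPerm t w) (t + n)) e
        ≡⟨ pipeCoeff-strip t (shiftPerm t w) n e sorted-strippable e≤t
             (λ i<t i<j → <⇒≤ (shiftPerm-prefix i<t i<j)) ⟩
      passes sorted e (applyUpTo (λ j → shiftPerm t w (t + j)) n)
        ≡⟨ cong (passes sorted e) (shifted n (oneLine w) λ j → trans (shiftPerm-≥ (m≤m+n t j))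
             (cong (λ k → t + oneLine w k) (m+n∸m≡n t j))) ⟩
      passes sorted e (map (t +_) word)
        ≡⟨ passes-shift t e (sorted-shift t) word ⟩
      passes sorted e word
        ≡⟨ passes-foldr sorted e word ⟩
      foldr pass sorted e word ∎))
    where
    shifted : ∀ n {u} v → (∀ j → u j ≡ t + v j) → applyUpTo u n ≡ map (t +_) (applyUpTo v n)
    shifted zero    v h = refl
    shifted (suc n) v h = cong₂ _∷_ (h 0) (shifted n (v ∘ suc) (h ∘ suc))

-- The support

-- A single path of a pass. Sums in ℕ do not cancel, so a positive `carry (suc p)` amounts to a path
-- with `p` jumps and positive weight at its end; the index shift is undone here.
data Carry : ℕ → List ℕ → ℕ → List ℕ → Set where
  done : Carry x [] 0 (x ∷ [])
  drop : Carry y l p l′ → Carry x (y ∷ l) p (x ∷ l′)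
  jump : y < x → Carry x l p l′ → Carry x (y ∷ l) (suc p) (y ∷ l′)

data Pass : List ℕ → ℕ → List ℕ → Set where
  nil  : Pass [] 0 []
  cons : Carry x l p l′ → Pass (x ∷ l) p l′

carry⇒Carry : ∀ p x l → 0 < carry (suc p) φ x l → ∃ λ l′ → Carry x l p l′ × 0 < φ l′
carry⇒Carry zero    x []      pos = x ∷ [] , done , pos
carry⇒Carry {φ} p x (y ∷ l) pos with carry (suc p) (φ ∘ (x ∷_)) y l in eq
... | suc _ with l′ , c , pos′ ← carry⇒Carry {φ ∘ (x ∷_)} p y l (subst (0 <_) (sym eq) z<s) =
  x ∷ l′ , drop c , pos′
carry⇒Carry {φ} p x (y ∷ l) pos | zero with y <? x
... | no y≮x rewrite <ᵇ-false (≮⇒≥ y≮x) with () ← pos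
carry⇒Carry {φ} zero x (y ∷ l) pos | zero | yes y<x
  rewrite <ᵇ-true y<x | carry-0 (φ ∘ (y ∷_)) x l with () ← pos
carry⇒Carry {φ} (suc p) x (y ∷ l) pos | zero | yes y<x
  rewrite <ᵇ-true y<x with l′ , c , pos′ ← carry⇒Carry {φ ∘ (y ∷_)} p x l pos =
  y ∷ l′ , jump y<x c , pos′

Carry⇒carry : Carry x l p l′ → 0 < φ l′ → 0 < carry (suc p) φ x l
Carry⇒carry done pos = pos
Carry⇒carry (drop c) pos = ≤-trans (Carry⇒carry c pos) (m≤m+n _ _)
Carry⇒carry {φ = φ} (jump {y} {x} {l} y<x c) pos rewrite <ᵇ-true y<x =
  ≤-trans (Carry⇒carry {φ = φ ∘ (y ∷_)} c pos) (m≤n+m _ _)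

pass⇒Pass : ∀ p l → 0 < pass p φ l → ∃ λ l′ → Pass l p l′ × 0 < φ l′
pass⇒Pass zero [] pos = [] , nil , pos
pass⇒Pass p (x ∷ l) pos with l′ , c , pos′ ← carry⇒Carry p x l pos = l′ , cons c , pos′

Pass⇒pass : Pass l p l′ → 0 < φ l′ → 0 < pass p φ l
Pass⇒pass nil      pos = pos
Pass⇒pass (cons c) pos = Carry⇒carry c pos

-- The list k holds the entries that precede l, so larger y k counts the inversions (z , y).
weigh : (ℕ → ℕ) → List ℕ → List ℕ → ℕ
weigh g k []      = 0
weigh g k (y ∷ l) = g (larger y k) + weigh g (y ∷ k) l

larger-> : ∀ {x y} k → x < y → larger x (y ∷ k) ≡ suc (larger x k)
larger-> k x<y rewrite <ᵇ-true x<y = refl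

larger-≤-∷ : ∀ {x y} k → y ≤ x → larger x (y ∷ k) ≡ larger x k
larger-≤-∷ k y≤x rewrite <ᵇ-false y≤x = refl

larger-anti : ∀ {x y} k → x ≤ y → larger y k ≤ larger x k
larger-anti []      x≤y = z≤n
larger-anti {x} {y} (z ∷ k) x≤y with y <? z
... | yes y<z rewrite <ᵇ-true y<z | <ᵇ-true (≤-<-trans x≤y y<z) = s≤s (larger-anti k x≤y)
... | no  y≮z rewrite <ᵇ-false (≮⇒≥ y≮z) = ≤-trans (larger-anti k x≤y) (m≤n+m _ (when (x <ᵇ z) 1))

larger-swap : ∀ x y k z → larger z (x ∷ y ∷ k) ≡ larger z (y ∷ x ∷ k)
larger-swap x y k z = x∙yz≈y∙xz (when (z <ᵇ x) 1) (when (z <ᵇ y) 1) (larger z k)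

weigh-cong : ∀ g {k k′} l → (∀ z → larger z k ≡ larger z k′) → weigh g k l ≡ weigh g k′ l
weigh-cong g []      eq = refl
weigh-cong g (y ∷ l) eq = cong₂ _+_ (cong g (eq y))
  (weigh-cong g l λ z → cong (when (z <ᵇ y) 1 +_) (eq z))

weigh-swap : ∀ g x y k l → weigh g (x ∷ y ∷ k) l ≡ weigh g (y ∷ x ∷ k) l
weigh-swap g x y k l = weigh-cong g l (larger-swap x y k)

weigh-mono : ∀ {g h} → (∀ c → g c ≤ h c) → ∀ k l → weigh g k l ≤ weigh h k l
weigh-mono g≤h k []      = z≤n
weigh-mono g≤h k (y ∷ l) = +-mono-≤ (g≤h _) (weigh-mono g≤h (y ∷ k) l)

-- Instantiated with R = ≤ and R = ≡; s is the contribution of a single jump.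
module _ (_R_ : ℕ → ℕ → Set) (R-refl : ∀ {a} → a R a)
         (R-+ : ∀ {a b c d} → a R b → c R d → (a + c) R (b + d))
         {s : ℕ} {g h : ℕ → ℕ} (stay : ∀ c → h c R g c) (move : ∀ c → (s + h c) R g (suc c)) where

  -- When `x` jumps over `y`, the count of `y` loses exactly the inversion with `x`. The count of
  -- `x` is unchanged because `y < x`, and later entries see the same predecessors in another order.
  -- Each jump thus uses `move` once, and every other entry uses `stay`.
  weigh-Carry : ∀ k → Carry x l p l′ → (p * s + weigh h k l′) R weigh g k (x ∷ l)
  weigh-Carry k done = R-+ (stay _) R-refl
  weigh-Carry {x} k (drop {y} {l} {p} {l′} c) =
    subst (_R weigh g k (x ∷ y ∷ l)) (x∙yz≈y∙xz (h (larger x k)) (p * s) (weigh h (x ∷ k) l′))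
      (R-+ (stay (larger x k)) (weigh-Carry (x ∷ k) c))
  weigh-Carry k (jump {y} {x} {l} {p} {l′} y<x c) = subst₂ _R_
    (interchange s (h (larger y k)) (p * s) (weigh h (y ∷ k) l′))
    (begin
      g (suc (larger y k)) + (g (larger x (y ∷ k)) + weigh g (x ∷ y ∷ k) l)
        ≡⟨ cong₂ (λ a b → g (suc (larger y k)) + (g a + b)) (larger-≤-∷ k (<⇒≤ y<x)) (weigh-swap g x y k l) ⟩
      g (suc (larger y k)) + (g (larger x k) + weigh g (y ∷ x ∷ k) l)
        ≡⟨ cong (λ a → g a + (g (larger x k) + weigh g (y ∷ x ∷ k) l)) (larger-> k y<x) ⟨
      g (larger y (x ∷ k)) + (g (larger x k) + weigh g (y ∷ x ∷ k) l)
        ≡⟨ x∙yz≈y∙xz (g (larger y (x ∷ k))) (g (larger x k)) _ ⟩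
      weigh g k (x ∷ y ∷ l) ∎)
    (R-+ (move (larger y k)) (weigh-Carry (y ∷ k) c))
    where open ≡-Reasoning

  weigh-Pass : Pass l p l′ → (p * s + weigh h [] l′) R weigh g [] l
  weigh-Pass nil      = R-refl
  weigh-Pass (cons c) = weigh-Carry [] c

capped : ℕ → List ℕ → ℕ
capped j = weigh (_⊓ j) []

inversions : List ℕ → ℕ
inversions = weigh id []

inversions-Pass : Pass l p l′ → p + inversions l′ ≡ inversions l
inversions-Pass {l} {p} {l′} π = subst (λ n → n + inversions l′ ≡ inversions l) (*-identityʳ p)
  (weigh-Pass _≡_ refl (cong₂ _+_) {1} (λ c → refl) (λ c → refl) π)

-- This serves the sets K that omit the pass. For those that contain it, `capped-Pass-take` raises
-- the cap by one to pay for at most one lost inversion per entry.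
capped-Pass-skip : ∀ j → Pass l p l′ → capped j l′ ≤ capped j l
capped-Pass-skip {l} {p} {l′} j π = subst (λ n → n + capped j l′ ≤ capped j l) (*-zeroʳ p)
  (weigh-Pass _≤_ ≤-refl +-mono-≤ {0} (λ c → ≤-refl) (λ c → ⊓-monoˡ-≤ j (n≤1+n c)) π)

capped-Pass-take : ∀ j → Pass l p l′ → p + capped j l′ ≤ capped (suc j) l
capped-Pass-take {l} {p} {l′} j π = subst (λ n → n + capped j l′ ≤ capped (suc j) l) (*-identityʳ p)
  (weigh-Pass _≤_ ≤-refl +-mono-≤ {1} (λ c → ⊓-monoʳ-≤ c (n≤1+n j)) (λ c → ≤-refl) π)

-- The greedy pass

atLeast : ℕ → ℕ → ℕ
atLeast t c = when (t ≤ᵇ c) 1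

atLeast-anti : ∀ t c → atLeast (suc t) c ≤ atLeast t c
atLeast-anti t c with suc t ≤? c
... | yes t<c rewrite ≤ᵇ-true t<c | ≤ᵇ-true (<⇒≤ t<c) = ≤-refl
... | no  t≮c rewrite ≤ᵇ-false (≰⇒> t≮c) = z≤n

module _ (τ : ℕ) where

  -- Conditions under which the inequality of `weigh-Carry` can be reversed for a pass that jumps
  -- only over entries of count at least `τ` and keeps only entries of count at most `τ`.
  record Selective (g h : ℕ → ℕ) (s : ℕ) : Set where
    field
      jumped : ∀ c → τ ≤ suc c → g (suc c) ≤ s + h c
      kept   : ∀ c → c ≤ τ → g c ≤ h c
  open Selective

  -- The field `gain` quantifies over `g`, `h` and `s` because one and the same pass must serve the
  -- inequalities for all sizes of K.
  record Greedy (k : List ℕ) (x : ℕ) (l : List ℕ) (p : ℕ) : Set where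
    constructor greedy
    field
      result : List ℕ
      path   : Carry x l p result
      gain   : ∀ {g h s} → Selective g h s → weigh g k (x ∷ l) ≤ p * s + weigh h k result

  N : ℕ → List ℕ → List ℕ → ℕ
  N t = weigh (atLeast t)

  greedy-drop : ∀ {k x y l p} → larger x k ≤ τ → Greedy (x ∷ k) y l p → Greedy k x (y ∷ l) p
  greedy-drop {k} {x} {y} {l} {p} cx≤τ (greedy l′ path gain) = greedy (x ∷ l′) (drop path)
    λ {g} {h} {s} sel → ≤-trans (+-mono-≤ (kept sel _ cx≤τ) (gain sel))
      (≤-reflexive (x∙yz≈y∙xz (h (larger x k)) (p * s) _))

  greedy-jump : ∀ {k x y l p} → y < x → τ ≤ larger y (x ∷ k) →
    Greedy (y ∷ k) x l p → Greedy k x (y ∷ l) (suc p)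
  greedy-jump {k} {x} {y} {l} {p} y<x τ≤c (greedy l′ path gain) = greedy (y ∷ l′) (jump y<x path)
    λ {g} {h} {s} sel → begin
      g (larger x k) + (g (larger y (x ∷ k)) + weigh g (y ∷ x ∷ k) l)
        ≡⟨ cong₂ (λ a b → a + (g (larger y (x ∷ k)) + b)) (cong g (larger-≤-∷ k (<⇒≤ y<x))) (weigh-swap g x y k l) ⟨
      g (larger x (y ∷ k)) + (g (larger y (x ∷ k)) + weigh g (x ∷ y ∷ k) l)
        ≡⟨ x∙yz≈y∙xz (g (larger x (y ∷ k))) (g (larger y (x ∷ k))) _ ⟩
      g (larger y (x ∷ k)) + weigh g (y ∷ k) (x ∷ l)
        ≡⟨ cong (λ c → g c + weigh g (y ∷ k) (x ∷ l)) (larger-> k y<x) ⟩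
      g (suc (larger y k)) + weigh g (y ∷ k) (x ∷ l)
        ≤⟨ +-mono-≤ (jumped sel (larger y k) (≤-trans τ≤c (≤-reflexive (larger-> k y<x)))) (gain sel) ⟩
      (s + h (larger y k)) + (p * s + weigh h (y ∷ k) l′)
        ≡⟨ interchange s (h (larger y k)) (p * s) (weigh h (y ∷ k) l′) ⟩
      (s + p * s) + (h (larger y k) + weigh h (y ∷ k) l′) ∎
    where open ≤-Reasoning

  -- Jump over the entries with more than τ inversions and over the leftmost r of those with exactly τ.
  -- A carried x is never jumped, so it fails this rule; hence a jumped y to its right is smaller.
  weigh-greedy : ∀ k x l r → larger x k ≤ τ → (larger x k ≡ τ → r ≡ 0) →
    N (suc τ) (x ∷ k) l + r ≤ N τ (x ∷ k) l → Greedy k x l (N (suc τ) (x ∷ k) l + r)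
  weigh-greedy k x [] zero cx≤τ tie room = greedy (x ∷ []) done λ sel → +-monoˡ-≤ 0 (kept sel _ cx≤τ)
  weigh-greedy k x (y ∷ l) r cx≤τ tie room with <-cmp (larger y (x ∷ k)) τ
  ... | tri< c<τ _ _ rewrite ≤ᵇ-false c<τ | ≤ᵇ-false (m<n⇒m<1+n c<τ) =
    greedy-drop cx≤τ (weigh-greedy (x ∷ k) y l r (<⇒≤ c<τ) (λ c≡τ → contradiction c≡τ (<⇒≢ c<τ)) room)
  ... | tri> _ _ τ<c rewrite ≤ᵇ-true τ<c | ≤ᵇ-true (<⇒≤ τ<c)
      | weigh-swap (atLeast (suc τ)) y x k l | weigh-swap (atLeast τ) y x k l =
    greedy-jump y<x (<⇒≤ τ<c) (weigh-greedy (y ∷ k) x l r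
      (subst (_≤ τ) (sym cx) cx≤τ) (tie ∘ trans (sym cx)) (≤-pred room))
    where
    y<x : y < x
    y<x = ≰⇒> λ x≤y → <⇒≱ τ<c (≤-trans (≤-reflexive (larger-≤-∷ k x≤y)) (≤-trans (larger-anti k x≤y) cx≤τ))
    cx : larger x (y ∷ k) ≡ larger x k
    cx = larger-≤-∷ k (<⇒≤ y<x)
  weigh-greedy k x (y ∷ l) zero cx≤τ tie room | tri≈ _ c≡τ _
    rewrite ≤ᵇ-false {suc τ} (s≤s (≤-reflexive c≡τ)) | ≤ᵇ-true (≤-reflexive (sym c≡τ)) =
    -- The quota of ties is used up, so `y` itself is carried next, with count exactly `τ`. The
    -- invariant therefore admits a carried entry of count `τ` only when `r` is 0.
    greedy-drop cx≤τ (weigh-greedy (x ∷ k) y l 0 (≤-reflexive c≡τ) (λ _ → refl)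
      (≤-trans (≤-reflexive (+-identityʳ _)) (weigh-mono (atLeast-anti τ) (y ∷ x ∷ k) l)))
  weigh-greedy k x (y ∷ l) (suc r) cx≤τ tie room | tri≈ _ c≡τ _
    rewrite ≤ᵇ-false {suc τ} (s≤s (≤-reflexive c≡τ)) | ≤ᵇ-true (≤-reflexive (sym c≡τ))
      | weigh-swap (atLeast (suc τ)) y x k l | weigh-swap (atLeast τ) y x k l
      | +-suc (N (suc τ) (x ∷ y ∷ k) l) r =
    greedy-jump y<x (≤-reflexive (sym c≡τ)) (weigh-greedy (y ∷ k) x l r
      (subst (_≤ τ) (sym cx) cx≤τ) (λ eq → case tie (trans (sym cx) eq) of λ ()) (≤-pred room))
    where
    y<x : y < x
    y<x = ≰⇒> λ x≤y → case tie (≤-antisym cx≤τ (begin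
      τ                  ≡⟨ c≡τ ⟨
      larger y (x ∷ k)   ≡⟨ larger-≤-∷ k x≤y ⟩
      larger y k         ≤⟨ larger-anti k x≤y ⟩
      larger x k         ∎)) of λ ()
      where open ≤-Reasoning
    cx : larger x (y ∷ k) ≡ larger x k
    cx = larger-≤-∷ k (<⇒≤ y<x)

weigh-atLeast-vanish : ∀ t k l → length k + length l < t → weigh (atLeast t) k l ≡ 0
weigh-atLeast-vanish t k []      lt = refl
weigh-atLeast-vanish t k (y ∷ l) lt
  rewrite ≤ᵇ-false {t} (≤-<-trans (larger-≤ y k) (≤-<-trans (m≤m+n _ (length (y ∷ l))) lt)) =
  weigh-atLeast-vanish t (y ∷ k) l (subst (_< t) (+-suc (length k) (length l)) lt)

-- The number of entries with count at least t decreases in t and vanishes beyond the total length,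
-- so an upward search meets the level at which it passes `p`. The search starts at 1 because the
-- first entry of a word has count 0 and must fall below the threshold to be carried.
threshold : ∀ p k l → p ≤ weigh (atLeast 1) k l →
  ∃₂ λ τ r → 1 ≤ τ × weigh (atLeast (suc τ)) k l + r ≡ p × p ≤ weigh (atLeast τ) k l
threshold p k l p≤ = search (length k + length l) 1 ≤-refl p≤ (m<m+n _ z<s)
  where
  search : ∀ d t → 1 ≤ t → p ≤ weigh (atLeast t) k l → length k + length l < d + t →
    ∃₂ λ τ r → 1 ≤ τ × weigh (atLeast (suc τ)) k l + r ≡ p × p ≤ weigh (atLeast τ) k l
  search zero t 1≤t p≤ lt = t , 0 , 1≤t , trans (+-identityʳ _)
    (trans (weigh-atLeast-vanish (suc t) k l (m<n⇒m<1+n lt))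
      (sym (n≤0⇒n≡0 (subst (p ≤_) (weigh-atLeast-vanish t k l lt) p≤)))) , p≤
  search (suc d) t 1≤t p≤ lt with weigh (atLeast (suc t)) k l ≤? p
  ... | yes n≤p = t , p ∸ weigh (atLeast (suc t)) k l , 1≤t , m+[n∸m]≡n n≤p , p≤
  ... | no  n≰p = search d (suc t) z<s (<⇒≤ (≰⇒> n≰p)) (subst (length k + length l <_) (sym (+-suc d t)) lt)

⊓1≤atLeast : ∀ c → c ⊓ 1 ≤ atLeast 1 c
⊓1≤atLeast zero    = z≤n
⊓1≤atLeast (suc c) = s≤s (≤-reflexive (⊓-zeroʳ c))

-- For a set of j remaining passes, the first alternative derives the new inequality from the old
-- one for the same set, the second from the old one for the set enlarged by the current pass.
GreedyPass : ℕ → List ℕ → Set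
GreedyPass p l = ∃ λ l′ → Pass l p l′ ×
  (∀ j → capped j l ≤ capped j l′ ⊎ capped (suc j) l ≤ p + capped j l′)

-- If `j < τ`, a jumped count is still at least j after losing one, so the cap at j hides the loss.
-- If `τ ≤ j`, the kept counts lie below both caps, and each jump accounts for at most one unit.
greedy⇒pass : ∀ τ {x l p} → Greedy τ [] x l p → GreedyPass p (x ∷ l)
greedy⇒pass τ {x} {l} {p} (greedy l′ path gain) = l′ , cons path , bound
  where
  bound : ∀ j → capped j (x ∷ l) ≤ capped j l′ ⊎ capped (suc j) (x ∷ l) ≤ p + capped j l′
  bound j with j <? τ
  ... | yes j<τ = inj₁ (subst (λ n → capped j (x ∷ l) ≤ n + capped j l′) (*-zeroʳ p) (gain {s = 0} record
    { jumped = λ c τ≤1+c → ≤-trans (m⊓n≤n (suc c) j) (≤-reflexive (sym (m≥n⇒m⊓n≡n (≤-pred (≤-trans j<τ τ≤1+c)))))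
    ; kept   = λ c _ → ≤-refl }))
  ... | no  j≮τ = inj₂ (subst (λ n → capped (suc j) (x ∷ l) ≤ n + capped j l′) (*-identityʳ p) (gain {s = 1} record
    { jumped = λ c _ → ≤-refl
    ; kept   = λ c c≤τ → ≤-trans (m⊓n≤m c (suc j)) (≤-reflexive (sym (m≤n⇒m⊓n≡m (≤-trans c≤τ (≮⇒≥ j≮τ))))) }))

greedy-pass : ∀ p l → p ≤ capped 1 l → GreedyPass p l
greedy-pass zero [] p≤ = [] , nil , λ j → inj₁ z≤n
greedy-pass p (x ∷ l) p≤
  with τ , r , 1≤τ , refl , p≤N ← threshold p (x ∷ []) l (≤-trans p≤ (weigh-mono ⊓1≤atLeast (x ∷ []) l)) =
  greedy⇒pass τ (weigh-greedy τ [] x l r z≤n (λ 0≡τ → contradiction 0≡τ (<⇒≢ 1≤τ)) p≤N)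

-- The inequalities that describe the support

inversions≡0⇒sorted : ∀ k l → weigh id k l ≡ 0 → sorted l ≡ 1 × All (λ y → larger y k ≡ 0) l
inversions≡0⇒sorted k []      eq = refl , []
inversions≡0⇒sorted k (x ∷ l) eq
  with sorted-l , l≤ ← inversions≡0⇒sorted (x ∷ k) l (m+n≡0⇒n≡0 (larger x k) eq) =
  cong₂ when (all-≤ᵇ-true (All.map (λ {y} → above y) l≤)) sorted-l ,
  m+n≡0⇒m≡0 (larger x k) eq ∷ All.map (λ {y} → m+n≡0⇒n≡0 (when (y <ᵇ x) 1)) l≤
  where
  above : ∀ y → larger y (x ∷ k) ≡ 0 → x ≤ y
  above y eq = ≮⇒≥ λ y<x → case trans (sym (larger-> k y<x)) eq of λ ()

sorted⇒inversions≡0 : ∀ k l → 0 < sorted l → All (λ y → larger y k ≡ 0) l → weigh id k l ≡ 0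
sorted⇒inversions≡0 k []      pos []         = refl
sorted⇒inversions≡0 k (x ∷ l) pos (x≡0 ∷ l≡0) with all (x ≤ᵇ_) l in eq
... | true = cong₂ _+_ x≡0 (sorted⇒inversions≡0 (x ∷ k) l pos (extend l eq l≡0))
  where
  extend : ∀ l → all (x ≤ᵇ_) l ≡ true → All (λ y → larger y k ≡ 0) l → All (λ y → larger y (x ∷ k) ≡ 0) l
  extend []      eq []          = []
  extend (y ∷ l) eq (y≡0 ∷ l≡0) with x ≤ᵇ y in x≤y
  ... | true = trans (larger-≤-∷ k (≤ᵇ⇒≤ x y (subst Bool.T (sym x≤y) _))) y≡0 ∷ extend l eq l≡0

inversions-sorted : ∀ l → 0 < sorted l → inversions l ≡ 0
inversions-sorted l pos = sorted⇒inversions≡0 [] l pos (All.universal (λ _ → refl) l)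

select : ∀ {m} → Vec Bool m → (Fin m → ℕ) → ℕ
select []      f = 0
select (b ∷ K) f = when b (f zero) + select K (f ∘ suc)

size : ∀ {m} → Vec Bool m → ℕ
size []      = 0
size (b ∷ K) = when b 1 + size K

select-none : ∀ m f → select (replicate m false) f ≡ 0
select-none zero    f = refl
select-none (suc m) f = select-none m (f ∘ suc)

size-none : ∀ m → size (replicate m false) ≡ 0
size-none zero    = refl
size-none (suc m) = size-none m

record Dominated {m} (l : List ℕ) (f : Fin m → ℕ) : Set where
  field
    bounded : ∀ K → select K f ≤ capped (size K) l
    total   : select (replicate m true) f ≡ inversions l
open Dominated

support⇒dominated : ∀ {m} (v : Vec ℕ m) l → 0 < foldr pass sorted (toList v) l → Dominated l (lookup v)
support⇒dominated [] l pos .bounded []  = z≤n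
support⇒dominated [] l pos .total = sym (inversions-sorted l pos)
support⇒dominated (p ∷ v) l pos
  with l′ , π , pos′ ← pass⇒Pass p l pos | support⇒dominated v l′ pos′
... | dom = λ where
  .bounded (true ∷ K) → ≤-trans (+-monoʳ-≤ p (bounded dom K)) (capped-Pass-take (size K) π)
  .bounded (false ∷ K) → ≤-trans (bounded dom K) (capped-Pass-skip (size K) π)
  .total → trans (cong (p +_) (total dom)) (inversions-Pass π)

dominated⇒support : ∀ {m} (v : Vec ℕ m) l → Dominated l (lookup v) → 0 < foldr pass sorted (toList v) l
dominated⇒support [] l dom = ≤-reflexive (sym (proj₁ (inversions≡0⇒sorted [] l (sym (total dom)))))
dominated⇒support {suc m} (p ∷ v) l dom
  -- For K consisting of the current pass alone, `bounded` says that `p` is at most the number of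
  -- entries with positive count, exactly what `greedy-pass` requires.
  with l′ , π , gain ← greedy-pass p l (subst₂ _≤_
         (trans (cong (p +_) (select-none m (lookup v))) (+-identityʳ p))
         (cong (λ j → capped (suc j) l) (size-none m)) (bounded dom (true ∷ replicate m false))) =
  Pass⇒pass π (dominated⇒support v l′ λ where
    .bounded K → case gain (size K) of λ where
      (inj₁ le) → ≤-trans (bounded dom (false ∷ K)) le
      (inj₂ le) → +-cancelˡ-≤ p _ _ (≤-trans (bounded dom (true ∷ K)) le)
    .total → +-cancelˡ-≡ p _ _ (trans (total dom) (sym (inversions-Pass π))))

-- Convexity

toℚ : ℕ → ℚ
toℚ n = ℤ.+ n ℚ./ 1

-- The fraction `toℚ n` is normalised through a gcd, which does not compute for a variable `n`.
-- Unnormalised fractions make the comparison with integers direct.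
toℚᵘ-toℚ : ∀ n → ℚ.toℚᵘ (toℚ n) ℚᵘ.≃ mkℚᵘ (ℤ.+ n) 0
toℚᵘ-toℚ n = ℚ.toℚᵘ-fromℚᵘ (mkℚᵘ (ℤ.+ n) 0)

toℚ-+ : ∀ m n → toℚ (m + n) ≡ toℚ m ℚ.+ toℚ n
toℚ-+ m n = ℚ.toℚᵘ-injective (begin
  ℚ.toℚᵘ (toℚ (m + n))                    ≈⟨ toℚᵘ-toℚ (m + n) ⟩
  mkℚᵘ (ℤ.+ (m + n)) 0                    ≈⟨ *≡* (cong (λ i → i ℤ.* ℤ.1ℤ) (sym (cong₂ ℤ._+_
                                               (ℤ.*-identityʳ (ℤ.+ m)) (ℤ.*-identityʳ (ℤ.+ n))))) ⟩
  mkℚᵘ (ℤ.+ m) 0 ℚᵘ.+ mkℚᵘ (ℤ.+ n) 0      ≈⟨ ℚᵘ.+-cong (toℚᵘ-toℚ m) (toℚᵘ-toℚ n) ⟨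
  ℚ.toℚᵘ (toℚ m) ℚᵘ.+ ℚ.toℚᵘ (toℚ n)      ≈⟨ ℚ.toℚᵘ-homo-+ (toℚ m) (toℚ n) ⟨
  ℚ.toℚᵘ (toℚ m ℚ.+ toℚ n)                ∎)
  where open ℚᵘ.≃-Reasoning

toℚ-mono-≤ : ∀ {m n} → m ≤ n → toℚ m ℚ.≤ toℚ n
toℚ-mono-≤ {m} {n} m≤n = ℚ.toℚᵘ-cancel-≤ (begin
  ℚ.toℚᵘ (toℚ m)  ≃⟨ toℚᵘ-toℚ m ⟩
  mkℚᵘ (ℤ.+ m) 0  ≤⟨ *≤* (ℤ.*-monoʳ-≤-nonNeg ℤ.1ℤ (ℤ.+≤+ m≤n)) ⟩
  mkℚᵘ (ℤ.+ n) 0  ≃⟨ toℚᵘ-toℚ n ⟨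
  ℚ.toℚᵘ (toℚ n)  ∎)
  where open ℚᵘ.≤-Reasoning

toℚ-cancel-≤ : ∀ {m n} → toℚ m ℚ.≤ toℚ n → m ≤ n
toℚ-cancel-≤ {m} {n} le = cancel (begin
  mkℚᵘ (ℤ.+ m) 0  ≃⟨ toℚᵘ-toℚ m ⟨
  ℚ.toℚᵘ (toℚ m)  ≤⟨ ℚ.toℚᵘ-mono-≤ le ⟩
  ℚ.toℚᵘ (toℚ n)  ≃⟨ toℚᵘ-toℚ n ⟩
  mkℚᵘ (ℤ.+ n) 0  ∎)
  where
  open ℚᵘ.≤-Reasoning
  cancel : mkℚᵘ (ℤ.+ m) 0 ℚᵘ.≤ mkℚᵘ (ℤ.+ n) 0 → m ≤ n
  cancel (*≤* le) = ℤ.drop‿+≤+ (ℤ.*-cancelʳ-≤-pos (ℤ.+ m) (ℤ.+ n) ℤ.1ℤ le)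

toℚ-injective : ∀ {m n} → toℚ m ≡ toℚ n → m ≡ n
toℚ-injective eq = ≤-antisym (toℚ-cancel-≤ (ℚ.≤-reflexive eq)) (toℚ-cancel-≤ (ℚ.≤-reflexive (sym eq)))

sumℚ : List ℚ → ℚ
sumℚ = foldr ℚ._+_ 0ℚ

module _ {A : Set} where

  average : (A → ℕ) → List (A × ℚ) → ℚ
  average f L = sumℚ (map (λ p → proj₂ p ℚ.* toℚ (f (proj₁ p))) L)

  average-zero : ∀ L → average (λ _ → 0) L ≡ 0ℚ
  average-zero []            = refl
  average-zero ((a , q) ∷ L) rewrite average-zero L | ℚ.*-zeroʳ q = refl

  average-+ : ∀ f g L → average (λ a → f a + g a) L ≡ average f L ℚ.+ average g L
  average-+ f g []            = refl
  average-+ f g ((a , q) ∷ L) = begin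
    q ℚ.* toℚ (f a + g a) ℚ.+ average (λ a → f a + g a) L
      ≡⟨ cong₂ ℚ._+_ (trans (cong (q ℚ.*_) (toℚ-+ (f a) (g a))) (ℚ.*-distribˡ-+ q _ _)) (average-+ f g L) ⟩
    (q ℚ.* toℚ (f a) ℚ.+ q ℚ.* toℚ (g a)) ℚ.+ (average f L ℚ.+ average g L)
      ≡⟨ ℚ-interchange (q ℚ.* toℚ (f a)) (q ℚ.* toℚ (g a)) (average f L) (average g L) ⟩
    average f ((a , q) ∷ L) ℚ.+ average g ((a , q) ∷ L) ∎
    where open ≡-Reasoning

  average-const : ∀ n L → average (λ _ → n) L ≡ sumℚ (map proj₂ L) ℚ.* toℚ n
  average-const n []            = sym (ℚ.*-zeroˡ (toℚ n))
  average-const n ((a , q) ∷ L) = trans (cong (q ℚ.* toℚ n ℚ.+_) (average-const n L))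
    (sym (ℚ.*-distribʳ-+ (toℚ n) q _))

  average-mono : ∀ {f g L} → All (λ p → 0ℚ ℚ.≤ proj₂ p) L →
    All (λ p → f (proj₁ p) ≤ g (proj₁ p)) L → average f L ℚ.≤ average g L
  average-mono []        []           = ℚ.≤-refl
  average-mono {L = (a , q) ∷ L} (0≤q ∷ nn) (f≤g ∷ fs≤gs) = ℚ.+-mono-≤
    (ℚ.*-monoˡ-≤-nonNeg q {{ℚ.nonNegative 0≤q}} (toℚ-mono-≤ f≤g)) (average-mono nn fs≤gs)

  average-select : ∀ {m} (K : Vec Bool m) (f : A → Fin m → ℕ) (g : Fin m → ℕ) L →
    (∀ i → average (λ a → f a i) L ≡ toℚ (g i)) → average (λ a → select K (f a)) L ≡ toℚ (select K g)
  average-select []          f g L eq = average-zero L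
  average-select (false ∷ K) f g L eq = average-select K (λ a → f a ∘ suc) (g ∘ suc) L (eq ∘ suc)
  average-select (true ∷ K)  f g L eq = trans (average-+ (λ a → f a zero) _ L)
    (trans (cong₂ ℚ._+_ (eq zero) (average-select K (λ a → f a ∘ suc) (g ∘ suc) L (eq ∘ suc)))
      (sym (toℚ-+ (g zero) _)))

-- The bounds depend on the word and on the size of K but not on the exponent vector, so averaging
-- with weights of sum 1 leaves them fixed.
dominated-convex : ∀ {m l} (L : List (Vec ℕ m × ℚ)) (β : Vec ℕ m) → ConvexCombination m L β →
  All (λ p → Dominated l (lookup (proj₁ p))) L → Dominated l (lookup β)
dominated-convex {m} {l} L β (nonneg , weights , eq) dom = record
  { bounded = λ K → toℚ-cancel-≤ (begin
      toℚ (select K (lookup β))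
        ≡⟨ average-select K lookup (lookup β) L eq ⟨
      average (λ α → select K (lookup α)) L
        ≤⟨ average-mono nonneg (All.map (λ d → bounded d K) dom) ⟩
      average (λ _ → capped (size K) l) L
        ≡⟨ average-constant (capped (size K) l) ⟩
      toℚ (capped (size K) l) ∎)
  ; total = toℚ-injective (ℚ.≤-antisym
      (begin
        toℚ (select full (lookup β))              ≡⟨ average-select full lookup (lookup β) L eq ⟨
        average (λ α → select full (lookup α)) L  ≤⟨ average-mono nonneg (All.map (≤-reflexive ∘ total) dom) ⟩
        average (λ _ → inversions l) L            ≡⟨ average-constant (inversions l) ⟩
        toℚ (inversions l)                        ∎)
      (begin
        toℚ (inversions l)                        ≡⟨ average-constant (inversions l) ⟨
        average (λ _ → inversions l) L            ≤⟨ average-mono nonneg (All.map (≤-reflexive ∘ sym ∘ total) dom) ⟩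
        average (λ α → select full (lookup α)) L  ≡⟨ average-select full lookup (lookup β) L eq ⟩
        toℚ (select full (lookup β))              ∎))
  }
  where
  open ℚ.≤-Reasoning
  full = replicate m true
  average-constant : ∀ n → average {Vec ℕ m} (λ _ → n) L ≡ toℚ n
  average-constant n = trans (average-const n L)
    (trans (cong (ℚ._* toℚ n) weights) (ℚ.*-identityˡ (toℚ n)))

module _ {n : ℕ} (1≤n : 1 ≤ n) (w : Permutation′ n) where

  InSupport⇒pos : ∀ e → InSupport w e → 0 < foldr pass sorted e (word w)
  InSupport⇒pos e (c , (t , eq) , c≢0) = n≢0⇒n>0 λ S≡0 → c≢0 (begin
    c
      ≡⟨ eq (t ⊔ length e) (m≤m⊔n t (length e)) ⟨
    coeff (schubShift (t ⊔ length e) w) e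
      ≡⟨ coeff-schubShift w 1≤n e (t ⊔ length e) (m≤n⊔m t (length e)) ⟩
    ℤ.+ foldr pass sorted e (word w)
      ≡⟨ cong ℤ.+_ S≡0 ⟩
    ℤ.0ℤ ∎)
    where open ≡-Reasoning

  pos⇒InSupport : ∀ e → 0 < foldr pass sorted e (word w) → InSupport w e
  pos⇒InSupport e pos =
    ℤ.+ foldr pass sorted e (word w) , (length e , coeff-schubShift w 1≤n e) ,
    λ S≡0 → >⇒≢ pos (ℤ.+-injective S≡0)

theorem5p8 : ∀ (n : ℕ) → 1 ≤ n → (w : Permutation′ n) → StanleySNP w
theorem5p8 n 1≤n w m L β supp convex = pos⇒InSupport 1≤n w (toList β)
  (dominated⇒support β (word w) (dominated-convex L β convex
    (All.map (λ {p} s → support⇒dominated (proj₁ p) (word w) (InSupport⇒pos 1≤n w _ s)) supp)))
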